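{- Let $t$ be a positive integer. (i) If $t\equiv 0\pmod 3$ and there exists an $SRG\left(n,\frac{n-1}{2},\frac{n-5}{4},\frac{n-1}{4}\right)$ with $n=\frac{4t}{3}+1$, then $r'_2(K_{2,t})=CR(K_{2,t},K_3)=\frac{4t}{3}+2$. (ii) If $t\equiv 0\pmod 2$ and there exists an $SRG\left(2t+1,t,\frac{t}{2}-1,\frac{t}{2}\right)$, then $r'_2(K_{3,t})=CR(K_{3,t},K_3)=2t+2$.
   Context: $SRG(n,k,\lambda,\mu)$ denotes a strongly regular graph with parameters $(n,k,\lambda,\mu)$: a $k$-regular graph on $n$ vertices in which any two adjacent vertices have exactly $\lambda$ common neighbors and any two distinct nonadjacent vertices have exactly $\mu$ common neighbors. An edge-colored graph $G$ on $p$ vertices with edge-coloring $\chi$ is called orderable if there exist an ordering $(v_1,\ldots,v_p)$ of $V(G)$ and a list $(c_1,\ldots,c_{p-1})$ of not necessarily distinct colors such that for every edge $v_iv_j\in E(G)$ with $i<j$ we have $\chi(v_iv_j)=c_i$. An edge-colored graph is rainbow if all its edges have pairwise different colors. For a graph $G$, $r'_2(G)$ is the minimum integer $n$ such that every 2-edge-coloring of $K_n$ (each edge gets one of two given colors) contains an orderable copy of $G$. For graphs $G,H$, $CR(G,H)$ is the minimum integer $n$ such that every edge-coloring of $K_n$ with any number of colors contains either an orderable copy of $G$ or a rainbow copy of $H$. Copies are (not necessarily induced) subgraphs with the inherited coloring. -}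

module Defs where

open import Data.Empty using (⊥)
open import Data.Fin.Base as Fin using (Fin; inject≤)
open import Data.Fin.Properties using (_≟_)
open import Data.Nat.Base using (ℕ; pred; _≤_)
open import Data.Nat.Properties using (pred[n]≤n)
open import Data.Product.Base using (∃; Σ-syntax; _×_)
open import Data.Sum.Base using (_⊎_; inj₁; inj₂)
open import Data.Unit.Base using (⊤)
open import Data.Vec.Base using (Vec; lookup; count; allFin)
open import Function.Bundles using (_↔_; _↣_; module Inverse; module Injection)
open import Level using (0ℓ)
open import Relation.Binary.Core using (Rel)
open import Relation.Binary.Definitions using (Decidable; Symmetric; Irreflexive)
open import Relation.Binary.PropositionalEquality using (_≡_; _≢_; refl; ≢-sym)
open import Relation.Nullary using (¬_; yes; no; ¬?; _×-dec_)

-- Finite simple graphs: adjacency is required to be decidable, as it always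
-- is classically.
record Graph (V : Set) : Set₁ where
  field
    Adj        : Rel V 0ℓ
    adj?       : Decidable Adj
    adj-sym    : Symmetric Adj
    adj-irrefl : Irreflexive _≡_ Adj

open Graph public

complete : (n : ℕ) → Graph (Fin n)
complete n = record
  { Adj        = _≢_
  ; adj?       = λ u v → ¬? (u ≟ v)
  ; adj-sym    = ≢-sym
  ; adj-irrefl = λ u≡v u≢v → u≢v u≡v
  }

module _ {A B : Set} where

  BipartiteAdj : Rel (A ⊎ B) 0ℓ
  BipartiteAdj (inj₁ _) (inj₁ _) = ⊥
  BipartiteAdj (inj₁ _) (inj₂ _) = ⊤
  BipartiteAdj (inj₂ _) (inj₁ _) = ⊤
  BipartiteAdj (inj₂ _) (inj₂ _) = ⊥

  bipartiteAdj? : Decidable BipartiteAdj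
  bipartiteAdj? (inj₁ _) (inj₁ _) = no λ ()
  bipartiteAdj? (inj₁ _) (inj₂ _) = yes _
  bipartiteAdj? (inj₂ _) (inj₁ _) = yes _
  bipartiteAdj? (inj₂ _) (inj₂ _) = no λ ()

  bipartiteAdj-sym : Symmetric BipartiteAdj
  bipartiteAdj-sym {inj₁ _} {inj₂ _} _ = _
  bipartiteAdj-sym {inj₂ _} {inj₁ _} _ = _

  bipartiteAdj-irrefl : Irreflexive _≡_ BipartiteAdj
  bipartiteAdj-irrefl {inj₁ _} refl ()
  bipartiteAdj-irrefl {inj₂ _} refl ()

completeBipartite : (a b : ℕ) → Graph (Fin a ⊎ Fin b)
completeBipartite a b = record
  { Adj        = BipartiteAdj
  ; adj?       = bipartiteAdj?
  ; adj-sym    = λ {u} {v} → bipartiteAdj-sym {x = u} {v}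
  ; adj-irrefl = bipartiteAdj-irrefl
  }

degree : ∀ {n} → Graph (Fin n) → Fin n → ℕ
degree {n} G u = count (adj? G u) (allFin n)

commonNeighbours : ∀ {n} → Graph (Fin n) → Fin n → Fin n → ℕ
commonNeighbours {n} G u v = count (λ w → adj? G u w ×-dec adj? G v w) (allFin n)

record IsSRG {n : ℕ} (G : Graph (Fin n)) (k l m : ℕ) : Set where
  field
    regular     : ∀ u → degree G u ≡ k
    adjacent    : ∀ u v → Adj G u v → commonNeighbours G u v ≡ l
    nonadjacent : ∀ u v → u ≢ v → ¬ Adj G u v → commonNeighbours G u v ≡ m

SRGExists : (n k l m : ℕ) → Set₁
SRGExists n k l m = Σ[ G ∈ Graph (Fin n) ] IsSRG G k l m

-- The law says that the colour depends only on the unordered edge; applied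
-- twice, it also makes the colour independent of the proof of adjacency.
record EdgeColouring {V : Set} (G : Graph V) (C : Set) : Set where
  field
    colour     : ∀ {u v} → Adj G u v → C
    colour-sym : ∀ {u v} (e : Adj G u v) (f : Adj G v u) → colour e ≡ colour f

open EdgeColouring public

-- Positions are numbered from 0, so the positions that carry a colour are
-- those of Fin (pred p), embedded in Fin p.
Orderable : ∀ {V C} {G : Graph V} → EdgeColouring G C → Set
Orderable {V} {C} {G} χ =
  ∃ λ (p : ℕ) → Σ[ σ ∈ Fin p ↔ V ] Σ[ c ∈ Vec C (pred p) ]
    let v = Inverse.to σ
        ι = λ (i : Fin (pred p)) → inject≤ i pred[n]≤n
    in ∀ (i : Fin (pred p)) (j : Fin p) → ι i Fin.< j →
       (e : Adj G (v (ι i)) (v j)) → colour χ e ≡ lookup c i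

Rainbow : ∀ {V C} {G : Graph V} → EdgeColouring G C → Set
Rainbow {G = G} χ =
  ∀ {u v x y} (e : Adj G u v) (f : Adj G x y) → colour χ e ≡ colour χ f →
  (u ≡ x × v ≡ y) ⊎ (u ≡ y × v ≡ x)

record Copy {W V : Set} (H : Graph W) (G : Graph V) : Set where
  field
    embedding : W ↣ V
    adj-pres  : ∀ {u v} → Adj H u v →
                Adj G (Injection.to embedding u) (Injection.to embedding v)

open Copy public

inherited : ∀ {W V C} {H : Graph W} {G : Graph V} →
            EdgeColouring G C → Copy H G → EdgeColouring H C
inherited χ κ = record
  { colour     = λ e → colour χ (adj-pres κ e)
  ; colour-sym = λ e f → colour-sym χ (adj-pres κ e) (adj-pres κ f)
  }

module _ {W V C : Set} {G : Graph V} (χ : EdgeColouring G C) (H : Graph W) where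

  HasOrderableCopy : Set
  HasOrderableCopy = Σ[ κ ∈ Copy H G ] Orderable (inherited χ κ)

  HasRainbowCopy : Set
  HasRainbowCopy = Σ[ κ ∈ Copy H G ] Rainbow (inherited χ κ)

IsMinimum : (ℕ → Set) → ℕ → Set
IsMinimum P m = P m × (∀ n → P n → m ≤ n)

-- r′₂ G ≔ m  says that r′₂(G) exists and equals m;  CR[ G , H ]≔ m  likewise.
infix 4 r′₂_≔_ CR[_,_]≔_

r′₂_≔_ : ∀ {V} → Graph V → ℕ → Set
r′₂ G ≔ m = IsMinimum
  (λ n → (χ : EdgeColouring (complete n) (Fin 2)) → HasOrderableCopy χ G) m

CR[_,_]≔_ : ∀ {V W} → Graph V → Graph W → ℕ → Set
CR[ G , H ]≔ m = IsMinimum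
  (λ n → ∀ r (χ : EdgeColouring (complete n) (Fin r)) →
         HasOrderableCopy χ G ⊎ HasRainbowCopy χ H) m

{-# OPTIONS --safe #-}

-- In both parts the graph is an SRG(4s+1, 2s, s-1, s), with t = 3s resp. t = 2s.
--
-- An orderable K_{2,t} with sides {a , b}, a before b, is the same as a colour α
-- and t vertices x with χ(ax) = χ(bx) or χ(ax) = α; K_{3,t} has a similar
-- description.  In the 2-colouring given by the strongly regular graph the number
-- of such x is computed exactly and falls one short of t.
--
-- For the upper bound take a colouring of K_{4s+2} without rainbow triangle.  A
-- vertex outside a connected component of a colour class sees that component in
-- one colour, and three colours cannot all be connected, so shrinking to
-- components ends in a set M of at least two vertices, using at most two colours,
-- whose members look alike from outside.  With a, b (and c) in M only vertices of
-- M can fail to fit, and averaging over the pairs (triples) of M, with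
-- 4·deg₁·deg₂ ≤ (|M| - 1)², produces a choice with few failures.
-- The shrinking argument is classical; it is carried out under a double negation,
-- which is harmless because the resulting configuration can be searched for.
module Submission where

open import Defs
import Algebra.Properties.Semiring.Sum as SemiringSum
open import Data.Bool.Base using (if_then_else_; true; false)
open import Data.Empty using (⊥; ⊥-elim)
open import Data.Fin.Base using (Fin; zero; suc; toℕ; fromℕ<; inject≤; opposite)
open import Data.Fin.Patterns using (0F; 1F; 2F)
open import Data.Fin.Properties
  using (_≟_; any?; all?; injective⇒≤; inject≤-injective; sequence; toℕ-injective; toℕ-inject≤; toℕ<n; toℕ-fromℕ<)
open import Data.List.Base as List using (List; []; _∷_; _++_; length; filter; tabulate)
open import Data.List.Membership.DecPropositional using (_∈?_)
open import Data.List.Membership.Propositional using (_∈_; _∉_)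
open import Data.List.Membership.Propositional.Properties
  using (∈-filter⁺; ∈-filter⁻; ∈-allFin; ∈-lookup; ∈-++⁺ˡ; ∈-++⁺ʳ; ∈-map⁺; ∈-map⁻)
open import Data.List.Properties using (filter-notAll)
open import Data.List.Relation.Binary.Permutation.Propositional using (↭⇒↭ₛ; ↭-sym)
open import Data.List.Relation.Binary.Permutation.Propositional.Properties using (∈-resp-↭)
import Data.List.Relation.Binary.Permutation.Setoid.Properties as Permutation
import Data.List.Relation.Unary.All as All
open import Data.List.Relation.Unary.AllPairs using (_∷_)
open import Data.List.Relation.Unary.Any as Any using (here; there; index)
open import Data.List.Relation.Unary.Any.Properties using (lookup-index)
open import Data.List.Relation.Unary.Sorted.TotalOrder.Properties using (lookup-mono-≤)
open import Data.List.Relation.Unary.Unique.Propositional using (Unique)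
import Data.List.Relation.Unary.Unique.Propositional.Properties as Unique
import Data.List.Sort as Sort
open import Data.Nat.Base
  using (ℕ; zero; suc; pred; _+_; _*_; _∸_; _/_; _≤_; _<_; z≤n; s≤s; >-nonZero)
open import Data.Nat.Divisibility using (_∣_; divides)
open import Data.Nat.DivMod using (m*n/n≡m; /-congˡ)
open import Data.Nat.Induction using (<-wellFounded)
open import Data.Nat.Properties hiding (_≟_)
open import Data.Nat.Tactic.RingSolver using (solve-∀)
open import Data.Product.Base using (∃-syntax; Σ-syntax; _×_; _,_; proj₁; proj₂)
open import Data.Sum.Base as Sum using (_⊎_; inj₁; inj₂)
open import Data.Sum.Properties using (inj₁-injective; inj₂-injective)
open import Data.Vec.Base as Vec using (count)
open import Data.Vec.Properties using (lookup∘tabulate)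
open import Effect.Monad using (RawMonad)
open import Function.Base using (_∘_; id)
open import Function.Bundles using (_↔_; mk↔ₛ′; mk↣; module Inverse; module Injection)
open import Function.Definitions using (Injective)
open import Induction.WellFounded using (Acc; acc)
open import Relation.Binary.Bundles using (DecTotalOrder)
open import Relation.Binary.Construct.Closure.ReflexiveTransitive using (Star; ε; _◅_; _◅◅_; reverse; map)
import Relation.Binary.Construct.On as On
open import Relation.Binary.Definitions using (DecidableEquality; tri<; tri≈; tri>)
open import Relation.Binary.PropositionalEquality
open import Relation.Nullary using (¬_; Dec; does; yes; no; contradiction; ¬?; _×-dec_; _⊎-dec_; _→-dec_)
open import Relation.Nullary.Decidable using (¬¬-excluded-middle; decidable-stable; from-yes)
open import Relation.Nullary.Negation using (¬¬-Monad)
open import Relation.Unary using (Pred; Decidable)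

-- Indicators, finite sums and cardinalities.

ind : ∀ {p} {P : Set p} → Dec P → ℕ
ind d = if does d then 1 else 0

ind-yes : ∀ {p} {P : Set p} (d : Dec P) → P → ind d ≡ 1
ind-yes (yes _)  _ = refl
ind-yes (no ¬p) p = contradiction p ¬p

ind-no : ∀ {p} {P : Set p} (d : Dec P) → ¬ P → ind d ≡ 0
ind-no (yes p) ¬p = contradiction p ¬p
ind-no (no _)  _  = refl

module +-*-∑ = SemiringSum +-*-semiring

-- Opaque, so that a sum over Fin (suc n) does not unfold and f is inferable from ∑ f.
opaque

  ∑ : ∀ {n} → (Fin n → ℕ) → ℕ
  ∑ = +-*-∑.sum

  ∑-cong : ∀ {n} {f g : Fin n → ℕ} → (∀ i → f i ≡ g i) → ∑ f ≡ ∑ g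
  ∑-cong = +-*-∑.sum-cong-≗

  ∑-distrib-+ : ∀ {n} (f g : Fin n → ℕ) → ∑ (λ i → f i + g i) ≡ ∑ f + ∑ g
  ∑-distrib-+ = +-*-∑.∑-distrib-+

  ∑-comm : ∀ {m n} (f : Fin m → Fin n → ℕ) → ∑ (λ i → ∑ λ j → f i j) ≡ ∑ λ j → ∑ λ i → f i j
  ∑-comm = +-*-∑.∑-comm

  *-distribˡ-∑ : ∀ {n} c (f : Fin n → ℕ) → c * ∑ f ≡ ∑ λ i → c * f i
  *-distribˡ-∑ = +-*-∑.*-distribˡ-sum

  *-distribʳ-∑ : ∀ {n} c (f : Fin n → ℕ) → ∑ f * c ≡ ∑ λ i → f i * c
  *-distribʳ-∑ = +-*-∑.*-distribʳ-sum

  ∑-mono-≤ : ∀ {n} {f g : Fin n → ℕ} → (∀ i → f i ≤ g i) → ∑ f ≤ ∑ g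
  ∑-mono-≤ {zero}  f≤g = z≤n
  ∑-mono-≤ {suc n} f≤g = +-mono-≤ (f≤g zero) (∑-mono-≤ (f≤g ∘ suc))

  ∑-const : ∀ n c → ∑ {n} (λ _ → c) ≡ n * c
  ∑-const zero    c = refl
  ∑-const (suc n) c = cong (c +_) (∑-const n c)

  count-tabulate : ∀ {a p} {A : Set a} {P : Pred A p} (P? : Decidable P) {n} (f : Fin n → A) →
                   count P? (Vec.tabulate f) ≡ ∑ λ i → ind (P? (f i))
  count-tabulate P? {zero}  f = refl
  count-tabulate P? {suc n} f with does (P? (f zero))
  ... | true  = cong suc (count-tabulate P? (f ∘ suc))
  ... | false = count-tabulate P? (f ∘ suc)

  length-filter-tabulate : ∀ {a p} {A : Set a} {P : Pred A p} (P? : Decidable P) {n} (f : Fin n → A) →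
                           length (filter P? (tabulate f)) ≡ ∑ λ i → ind (P? (f i))
  length-filter-tabulate P? {zero}  f = refl
  length-filter-tabulate P? {suc n} f with does (P? (f zero))
  ... | true  = cong suc (length-filter-tabulate P? (f ∘ suc))
  ... | false = length-filter-tabulate P? (f ∘ suc)

∑-*-∑ : ∀ {m n} (f : Fin m → ℕ) (g : Fin n → ℕ) →
        ∑ f * ∑ g ≡ ∑ λ i → ∑ λ j → f i * g j
∑-*-∑ f g = trans (*-distribʳ-∑ (∑ g) f) (∑-cong λ i → *-distribˡ-∑ (f i) g)

# : ∀ {n p} {P : Pred (Fin n) p} → Decidable P → ℕ
# P? = ∑ λ x → ind (P? x)

lookup-injective : ∀ {a} {A : Set a} {xs : List A} → Unique xs →
                   Injective _≡_ _≡_ (List.lookup xs)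
lookup-injective (x∉ ∷ u) {zero}  {zero}  eq = refl
lookup-injective {xs = x ∷ xs} (x∉ ∷ u) {zero}  {suc j} eq = contradiction eq (All.lookup x∉ (∈-lookup {xs = xs} j))
lookup-injective {xs = x ∷ xs} (x∉ ∷ u) {suc i} {zero}  eq = contradiction (sym eq) (All.lookup x∉ (∈-lookup {xs = xs} i))
lookup-injective (x∉ ∷ u) {suc i} {suc j} eq = cong suc (lookup-injective u eq)

module _ {n p} {P : Pred (Fin n) p} (P? : Decidable P) where

  private
    xs = filter P? (List.allFin n)

    length-xs : length xs ≡ # P?
    length-xs = length-filter-tabulate P? id

  -- Together with `injection⇒≤#` this exchanges counting inequalities for families of distinct
  -- vertices, the form in which one side of a bipartite copy is given.
  ≤#⇒injection : ∀ {t} → t ≤ # P? →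
                 Σ[ g ∈ (Fin t → Fin n) ] Injective _≡_ _≡_ g × (∀ j → P (g j))
  ≤#⇒injection t≤# =
      (λ j → List.lookup xs (inject≤ j t≤))
    , (λ eq → inject≤-injective t≤ t≤ _ _ (lookup-injective (Unique.filter⁺ P? (Unique.allFin⁺ n)) eq))
    , λ j → proj₂ (∈-filter⁻ P? {xs = List.allFin n} (∈-lookup {xs = xs} (inject≤ j t≤)))
    where t≤ = subst (_ ≤_) (sym length-xs) t≤#

  injection⇒≤# : ∀ {t} {g : Fin t → Fin n} → Injective _≡_ _≡_ g → (∀ j → P (g j)) → t ≤ # P?
  injection⇒≤# {t} {g} g-inj Pg = subst (t ≤_) length-xs (injective⇒≤ λ {i} {j} eq →
    g-inj (trans (lookup-index (mem i)) (trans (cong (List.lookup xs) eq) (sym (lookup-index (mem j))))))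
    where
    mem : ∀ j → g j ∈ xs
    mem j = ∈-filter⁺ P? (∈-allFin (g j)) (Pg j)

-- The adjacency matrix of the complete graph. A factor `ne v x` removes the term at `v` from a sum
-- over `x`.
ne : ∀ {n} → Fin n → Fin n → ℕ
ne x y = ind (¬? (x ≟ y))

ne-≢ : ∀ {n} {x y : Fin n} → x ≢ y → ne x y ≡ 1
ne-≢ = ind-yes (¬? (_ ≟ _))

ne-refl : ∀ {n} (x : Fin n) → ne x x ≡ 0
ne-refl x = ind-no (¬? (x ≟ x)) λ x≢x → x≢x refl

ne-sym : ∀ {n} (x y : Fin n) → ne x y ≡ ne y x
ne-sym x y with y ≟ x
... | yes refl = ne-refl x
... | no y≢x = ne-≢ (y≢x ∘ sym)

opaque
  unfolding ∑

  -- Adding the omitted term on the left avoids truncated subtraction; iteration evaluates sums with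
  -- two or three vertices left out.
  ∑-except : ∀ {n} (f : Fin n → ℕ) v → ∑ (λ x → f x * ne v x) + f v ≡ ∑ f
  ∑-except f zero = begin
    f zero * 0 + ∑ (λ x → f (suc x) * 1) + f zero ≡⟨ cong₂ (λ y z → y + z + f zero) (*-zeroʳ (f zero)) (∑-cong λ x → *-identityʳ (f (suc x))) ⟩
    ∑ (λ x → f (suc x)) + f zero                  ≡⟨ +-comm _ (f zero) ⟩
    ∑ f                                           ∎
    where open ≡-Reasoning
  ∑-except f (suc v) = begin
    f zero * 1 + ∑ (λ x → f (suc x) * ne v x) + f (suc v)   ≡⟨ cong (λ y → y + ∑ (λ x → f (suc x) * ne v x) + f (suc v)) (*-identityʳ (f zero)) ⟩
    f zero + ∑ (λ x → f (suc x) * ne v x) + f (suc v)       ≡⟨ +-assoc (f zero) _ _ ⟩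
    f zero + (∑ (λ x → f (suc x) * ne v x) + f (suc v))     ≡⟨ cong (f zero +_) (∑-except (f ∘ suc) v) ⟩
    ∑ f                                                     ∎
    where open ≡-Reasoning

module _ {n : ℕ} where

  ∑-ne : (a : Fin n) → ∑ (ne a) + 1 ≡ n
  ∑-ne a = begin
    ∑ (ne a) + 1                  ≡⟨ cong (_+ 1) (∑-cong λ x → *-identityˡ (ne a x)) ⟨
    ∑ (λ x → 1 * ne a x) + 1      ≡⟨ ∑-except (λ _ → 1) a ⟩
    ∑ {n} (λ _ → 1)               ≡⟨ ∑-const n 1 ⟩
    n * 1                           ≡⟨ *-identityʳ n ⟩
    n                               ∎
    where open ≡-Reasoning

  ∑-ne-ne : {a b : Fin n} → a ≢ b → ∑ (λ x → ne a x * ne b x) + 2 ≡ n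
  ∑-ne-ne {a} {b} a≢b = begin
    ∑ (λ x → ne a x * ne b x) + 2            ≡⟨ +-assoc _ 1 1 ⟨
    ∑ (λ x → ne a x * ne b x) + 1 + 1        ≡⟨ cong (λ y → ∑ (λ x → ne a x * ne b x) + y + 1) (ne-≢ a≢b) ⟨
    ∑ (λ x → ne a x * ne b x) + ne a b + 1   ≡⟨ cong (_+ 1) (∑-except (ne a) b) ⟩
    ∑ (ne a) + 1                             ≡⟨ ∑-ne a ⟩
    n                                          ∎
    where open ≡-Reasoning

  ∑-ne-ne-ne : {a b c : Fin n} → a ≢ b → a ≢ c → b ≢ c →
                 ∑ (λ x → ne a x * ne b x * ne c x) + 3 ≡ n
  ∑-ne-ne-ne {a} {b} {c} a≢b a≢c b≢c = begin
    ∑ (λ x → ne a x * ne b x * ne c x) + 3                     ≡⟨ +-assoc _ 1 2 ⟨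
    ∑ (λ x → ne a x * ne b x * ne c x) + 1 + 2                 ≡⟨ cong (λ y → ∑ (λ x → ne a x * ne b x * ne c x) + y + 2) (cong₂ _*_ (ne-≢ a≢c) (ne-≢ b≢c)) ⟨
    ∑ (λ x → ne a x * ne b x * ne c x) + ne a c * ne b c + 2   ≡⟨ cong (_+ 2) (∑-except (λ x → ne a x * ne b x) c) ⟩
    ∑ (λ x → ne a x * ne b x) + 2                              ≡⟨ ∑-ne-ne a≢b ⟩
    n                                                            ∎
    where open ≡-Reasoning

-- Averaging over pairs and triples of vertices of a 2-coloured complete graph

-- The difference of the two sides is the square of q - p. To stay in the naturals, the larger
-- number is written as the smaller one plus `d`.
4pq≤[p+q]² : ∀ p q → 4 * (p * q) ≤ (p + q) * (p + q)
4pq≤[p+q]² p q with ≤-total p q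
... | inj₁ p≤q = subst (λ q → 4 * (p * q) ≤ (p + q) * (p + q)) (m+[n∸m]≡n p≤q) (lemma p (q ∸ p))
  where
  lemma : ∀ p d → 4 * (p * (p + d)) ≤ (p + (p + d)) * (p + (p + d))
  lemma p d = subst (4 * (p * (p + d)) ≤_) (eq p d) (m≤m+n _ (d * d))
    where
    eq : ∀ p d → 4 * (p * (p + d)) + d * d ≡ (p + (p + d)) * (p + (p + d))
    eq = solve-∀
... | inj₂ q≤p = subst (λ p → 4 * (p * q) ≤ (p + q) * (p + q)) (m+[n∸m]≡n q≤p) (lemma q (p ∸ q))
  where
  lemma : ∀ q d → 4 * ((q + d) * q) ≤ ((q + d) + q) * ((q + d) + q)
  lemma q d = subst (4 * ((q + d) * q) ≤_) (eq q d) (m≤m+n _ (d * d))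
    where
    eq : ∀ q d → 4 * ((q + d) * q) + d * d ≡ ((q + d) + q) * ((q + d) + q)
    eq = solve-∀

∑₃ : ∀ {m} → (Fin m → Fin m → Fin m → ℕ) → ℕ
∑₃ h = ∑ λ a → ∑ λ b → ∑ λ c → h a b c

∑₂-cong : ∀ {m} {h h′ : Fin m → Fin m → ℕ} →
            (∀ a b → h a b ≡ h′ a b) → ∑ (λ a → ∑ (h a)) ≡ ∑ (λ a → ∑ (h′ a))
∑₂-cong eq = ∑-cong λ a → ∑-cong (eq a)

∑₂-mono-≤ : ∀ {m} {h h′ : Fin m → Fin m → ℕ} →
              (∀ a b → h a b ≤ h′ a b) → ∑ (λ a → ∑ (h a)) ≤ ∑ (λ a → ∑ (h′ a))
∑₂-mono-≤ le = ∑-mono-≤ λ a → ∑-mono-≤ (le a)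

∑₃-cong : ∀ {m} {h h′ : Fin m → Fin m → Fin m → ℕ} →
            (∀ a b c → h a b c ≡ h′ a b c) → ∑₃ h ≡ ∑₃ h′
∑₃-cong eq = ∑-cong λ a → ∑₂-cong (eq a)

∑₃-mono-≤ : ∀ {m} {h h′ : Fin m → Fin m → Fin m → ℕ} →
              (∀ a b c → h a b c ≤ h′ a b c) → ∑₃ h ≤ ∑₃ h′
∑₃-mono-≤ le = ∑-mono-≤ λ a → ∑₂-mono-≤ (le a)

∑₂-distrib-+ : ∀ {m} (h h′ : Fin m → Fin m → ℕ) →
  ∑ (λ a → ∑ λ b → h a b + h′ a b) ≡ ∑ (λ a → ∑ (h a)) + ∑ (λ a → ∑ (h′ a))
∑₂-distrib-+ h h′ = trans (∑-cong λ a → ∑-distrib-+ (h a) (h′ a)) (∑-distrib-+ (∑ ∘ h) (∑ ∘ h′))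

∑₃-distrib-+ : ∀ {m} (h h′ : Fin m → Fin m → Fin m → ℕ) →
  ∑₃ (λ a b c → h a b c + h′ a b c) ≡ ∑₃ h + ∑₃ h′
∑₃-distrib-+ h h′ = trans (∑-cong λ a → ∑₂-distrib-+ (h a) (h′ a)) (∑-distrib-+ _ _)

∑₂-∑-comm : ∀ {m n} (h : Fin m → Fin m → Fin n → ℕ) →
  ∑ (λ a → ∑ λ b → ∑ (h a b)) ≡ ∑ λ x → ∑ λ a → ∑ λ b → h a b x
∑₂-∑-comm h = trans (∑-cong λ a → ∑-comm (h a)) (∑-comm λ a x → ∑ λ b → h a b x)

∑₃-∑-comm : ∀ {m n} (h : Fin m → Fin m → Fin m → Fin n → ℕ) →
  ∑₃ (λ a b c → ∑ (h a b c)) ≡ ∑ λ x → ∑₃ λ a b c → h a b c x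
∑₃-∑-comm h = trans (∑-cong λ a → ∑₂-∑-comm (h a)) (∑-comm λ a x → ∑ λ b → ∑ λ c → h a b c x)

∑₃-rotate : ∀ {m} (h : Fin m → Fin m → Fin m → ℕ) → ∑₃ h ≡ ∑₃ λ b c a → h a b c
∑₃-rotate h = trans (∑-comm λ a b → ∑ (h a b)) (∑-cong λ b → ∑-comm λ a c → h a b c)

ne-*-≤ : ∀ {n} (x y : Fin n) σ {τ} → (x ≢ y → σ ≤ τ) → ne x y * σ ≤ τ
ne-*-≤ x y σ le with x ≟ y
... | yes _  = z≤n
... | no x≢y = subst (_≤ _) (sym (+-identityʳ σ)) (le x≢y)

-- R and L are the adjacency matrices of a graph and of its complement.
module _ {m : ℕ} (R L : Fin m → Fin m → ℕ) (R+L≡ne : ∀ x y → R x y + L x y ≡ ne x y) where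

  private
    0-diagonal : ∀ {x y} → x ≡ y → R x y ≡ 0 × L x y ≡ 0
    0-diagonal {x} refl = m+n≡0⇒m≡0 _ eq , m+n≡0⇒n≡0 (R x x) eq
      where eq = trans (R+L≡ne x x) (ne-refl x)

    degrees : ∀ x → ∑ (R x) + ∑ (L x) + 1 ≡ m
    degrees x = trans (cong (_+ 1) (trans (sym (∑-distrib-+ (R x) (L x))) (∑-cong (R+L≡ne x)))) (∑-ne x)

    -- The two degrees at `x` sum to the number `k` of other vertices, so their product is at most a
    -- quarter of its square.
    4*bichromatic≤ : ∀ {k} → m ≡ suc k → ∀ x → 4 * (∑ (L x) * ∑ (R x)) ≤ k * k
    4*bichromatic≤ {k} m≡ x = ≤-trans (4pq≤[p+q]² (∑ (L x)) (∑ (R x))) (≤-reflexive (cong₂ _*_ eq eq))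
      where
      eq : ∑ (L x) + ∑ (R x) ≡ k
      eq = suc-injective (begin
        suc (∑ (L x) + ∑ (R x)) ≡⟨ cong suc (+-comm (∑ (L x)) _) ⟩
        suc (∑ (R x) + ∑ (L x)) ≡⟨ +-comm 1 _ ⟩
        ∑ (R x) + ∑ (L x) + 1   ≡⟨ degrees x ⟩
        m                           ≡⟨ m≡ ⟩
        suc k                       ∎)
        where open ≡-Reasoning

  -- Double counting of the triples (a, b, x) weighted by `L x a * R x b`: the total is at least m(m
  -- - 1)σ, and each `x` contributes at most (m - 1)²/4.
  pair-average : ∀ {k σ} → m ≡ 2 + k →
    (∀ a b → a ≢ b → σ ≤ ∑ λ x → L x a * R x b) → 4 * σ ≤ suc k
  pair-average {k} {σ} refl σ≤ =
    *-cancelˡ-≤ (suc k) (*-cancelˡ-≤ m (begin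
      m * (suc k * (4 * σ))                                          ≡⟨ eq m (suc k) σ ⟩
      4 * (m * (suc k * σ))                                          ≡⟨ cong (4 *_) count-pairs ⟨
      4 * (∑ λ a → ∑ λ b → ne a b * σ)                           ≤⟨ *-monoʳ-≤ 4 (∑₂-mono-≤ λ a b → ne-*-≤ a b σ (σ≤ a b)) ⟩
      4 * (∑ λ a → ∑ λ b → ∑ λ x → L x a * R x b)              ≡⟨ cong (4 *_) (∑₂-∑-comm λ a b x → L x a * R x b) ⟩
      4 * (∑ λ x → ∑ λ a → ∑ λ b → L x a * R x b)              ≡⟨ cong (4 *_) (∑-cong λ x → ∑-*-∑ (L x) (R x)) ⟨
      4 * (∑ λ x → ∑ (L x) * ∑ (R x))                          ≡⟨ *-distribˡ-∑ 4 _ ⟩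
      (∑ λ x → 4 * (∑ (L x) * ∑ (R x)))                        ≤⟨ ∑-mono-≤ (4*bichromatic≤ refl) ⟩
      ∑ {m} (λ _ → suc k * suc k)                                  ≡⟨ ∑-const m _ ⟩
      m * (suc k * suc k)                                            ∎))
    where
    open ≤-Reasoning
    eq : ∀ m k σ → m * (k * (4 * σ)) ≡ 4 * (m * (k * σ))
    eq = solve-∀
    count-pairs : (∑ λ a → ∑ λ (b : Fin m) → ne a b * σ) ≡ m * (suc k * σ)
    count-pairs = trans
      (∑-cong λ a → trans (sym (*-distribʳ-∑ σ (ne a)))
        (cong (_* σ) (suc-injective (trans (+-comm 1 _) (∑-ne a)))))
      (∑-const m _)

  private
    distinct : Fin m → Fin m → Fin m → ℕ
    distinct a b c = ne a b * ne a c * ne b c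

    distinct-rotate : ∀ a b c → distinct a b c ≡ distinct b c a
    distinct-rotate a b c rewrite ne-sym b a | ne-sym c a = eq (ne a b) (ne a c) (ne b c)
      where
      eq : ∀ x y z → x * y * z ≡ z * x * y
      eq = solve-∀

    module _ {k : ℕ} (m≡3+k : m ≡ 3 + k) where

      drop-3 : ∀ {j} → j + 3 ≡ m → j ≡ k
      drop-3 eq = +-cancelʳ-≡ 3 _ k (trans eq (trans m≡3+k (+-comm 3 k)))

      count-triples : ∀ σ → ∑₃ (λ a b c → distinct a b c * σ) ≡ m * ((2 + k) * ((1 + k) * σ))
      count-triples σ = trans (∑-cong row) (∑-const m _)
        where
        open ≡-Reasoning
        inner : ∀ a b → ∑ (λ c → distinct a b c * σ) ≡ ne a b * ((1 + k) * σ)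
        inner a b with a ≟ b
        ... | yes refl = trans (∑-const m 0) (*-zeroʳ m)
        ... | no a≢b = begin
          ∑ (λ c → (ne a c + 0) * ne b c * σ) ≡⟨ ∑-cong (λ c → cong (λ y → y * ne b c * σ) (+-identityʳ (ne a c))) ⟩
          ∑ (λ c → ne a c * ne b c * σ)     ≡⟨ *-distribʳ-∑ σ _ ⟨
          ∑ (λ c → ne a c * ne b c) * σ     ≡⟨ cong (_* σ) (+-cancelʳ-≡ 2 _ (1 + k) (trans (∑-ne-ne a≢b) (trans m≡3+k (+-comm 2 (1 + k))))) ⟩
          (1 + k) * σ                         ≡⟨ +-identityʳ _ ⟨
          (1 + k) * σ + 0                     ∎
        row : ∀ a → ∑ (λ b → ∑ λ c → distinct a b c * σ) ≡ (2 + k) * ((1 + k) * σ)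
        row a = begin
          ∑ (λ b → ∑ λ c → distinct a b c * σ) ≡⟨ ∑-cong (inner a) ⟩
          ∑ (λ b → ne a b * ((1 + k) * σ))       ≡⟨ *-distribʳ-∑ _ (ne a) ⟨
          ∑ (ne a) * ((1 + k) * σ)               ≡⟨ cong (_* ((1 + k) * σ)) (+-cancelʳ-≡ 1 _ (2 + k) (trans (∑-ne a) (trans m≡3+k (+-comm 1 (2 + k))))) ⟩
          (2 + k) * ((1 + k) * σ)                  ∎

      -- Where `h a b` is nonzero, `x` differs from `a` and `b`; if also `a ≢ b`, then `c` must
      -- avoid three points and has k = m - 3 choices. All other pairs contribute zero on the left.
      third-point : ∀ x (h : Fin m → Fin m → ℕ) →
        (∀ a b → x ≡ a → h a b ≡ 0) → (∀ a b → x ≡ b → h a b ≡ 0) →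
        ∑₃ (λ a b c → distinct a b c * (ne x c * h a b)) ≤ k * ∑ (λ a → ∑ λ b → h a b)
      third-point x h h≡0ˡ h≡0ʳ = begin
        ∑₃ (λ a b c → distinct a b c * (ne x c * h a b)) ≤⟨ ∑₂-mono-≤ inner ⟩
        ∑ (λ a → ∑ λ b → k * h a b)                    ≡⟨ ∑-cong (λ a → *-distribˡ-∑ k (h a)) ⟨
        ∑ (λ a → k * ∑ (h a))                          ≡⟨ *-distribˡ-∑ k _ ⟨
        k * ∑ (λ a → ∑ (h a))                          ∎
        where
        open ≤-Reasoning
        vanish : ∀ {a b} → h a b ≡ 0 → ∑ (λ c → distinct a b c * (ne x c * h a b)) ≤ k * h a b
        vanish {a} {b} h≡0 = begin
          ∑ (λ c → distinct a b c * (ne x c * h a b)) ≡⟨ ∑-cong (λ c → trans (cong (λ y → distinct a b c * (ne x c * y)) h≡0) (trans (cong (distinct a b c *_) (*-zeroʳ (ne x c))) (*-zeroʳ (distinct a b c)))) ⟩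
          ∑ {m} (λ _ → 0)                             ≡⟨ trans (∑-const m 0) (*-zeroʳ m) ⟩
          0                                             ≤⟨ z≤n ⟩
          k * h a b                                     ∎
        eq : ∀ p q r y → (1 * p) * q * (r * y) ≡ p * q * r * y
        eq = solve-∀
        inner : ∀ a b → ∑ (λ c → distinct a b c * (ne x c * h a b)) ≤ k * h a b
        inner a b = cases (x ≟ a) (x ≟ b) (a ≟ b)
          where
          cases : Dec (x ≡ a) → Dec (x ≡ b) → Dec (a ≡ b) →
                  ∑ (λ c → distinct a b c * (ne x c * h a b)) ≤ k * h a b
          cases (yes x≡a) _ _ = vanish (h≡0ˡ a b x≡a)
          cases (no _) (yes x≡b) _ = vanish (h≡0ʳ a b x≡b)
          cases (no _) (no _) (yes refl) = begin
            ∑ (λ c → distinct a a c * (ne x c * h a a)) ≡⟨ ∑-cong (λ c → cong (λ y → y * ne a c * ne a c * (ne x c * h a a)) (ne-refl a)) ⟩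
            ∑ {m} (λ _ → 0)                             ≡⟨ trans (∑-const m 0) (*-zeroʳ m) ⟩
            0                                             ≤⟨ z≤n ⟩
            k * h a a                                     ∎
          cases (no x≢a) (no x≢b) (no a≢b) = begin
            ∑ (λ c → distinct a b c * (ne x c * h a b))          ≡⟨ ∑-cong (λ c → trans (cong (λ y → y * ne a c * ne b c * (ne x c * h a b)) (ne-≢ a≢b)) (eq (ne a c) (ne b c) (ne x c) (h a b))) ⟩
            ∑ (λ c → ne a c * ne b c * ne x c * h a b)           ≡⟨ *-distribʳ-∑ (h a b) _ ⟨
            ∑ (λ c → ne a c * ne b c * ne x c) * h a b           ≡⟨ cong (_* h a b) (drop-3 (∑-ne-ne-ne a≢b (x≢a ∘ sym) (x≢b ∘ sym))) ⟩
            k * h a b                                              ∎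

  -- Double counting over ordered triples of distinct vertices: both summands have the same total,
  -- so each `x` contributes at most 2k times the product of its two degrees. After cancellation
  -- this reads 2σ(1 + k) ≤ k(2 + k).
  triple-average : ∀ {k σ} → m ≡ 3 + k →
    (∀ a b c → a ≢ b → a ≢ c → b ≢ c →
     σ ≤ ∑ λ x → ne x c * (L x a * R x b) + ne x a * (L x b * R x c)) →
    -- The right side of `bound` is (1 + k)² - 1, hence 2σ < 1 + k.
    2 * σ ≤ k
  triple-average {k} {σ} refl σ≤ = ≮⇒≥ λ k<2σ → <⇒≱ (n<1+n _)
    (≤-trans (≤-trans (≤-reflexive (eq₁ k)) (*-monoˡ-≤ (1 + k) k<2σ)) bound)
    where
    open ≤-Reasoning
    g : Fin m → Fin m → Fin m → Fin m → ℕ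
    g a b c x = ne x c * (L x a * R x b) + ne x a * (L x b * R x c)

    LR : Fin m → Fin m → Fin m → ℕ
    LR x a b = L x a * R x b

    product-0ˡ : ∀ x a b → x ≡ a → L x a * R x b ≡ 0
    product-0ˡ x a b x≡a = cong (_* R x b) (proj₂ (0-diagonal x≡a))

    product-0ʳ : ∀ x a b → x ≡ b → L x a * R x b ≡ 0
    product-0ʳ x a b x≡b = trans (cong (L x a *_) (proj₁ (0-diagonal x≡b))) (*-zeroʳ (L x a))

    at-x : ∀ x → ∑₃ (λ a b c → distinct a b c * g a b c x) ≤ 2 * (k * (∑ (L x) * ∑ (R x)))
    at-x x = begin
      ∑₃ (λ a b c → distinct a b c * g a b c x)
        ≡⟨ ∑₃-cong (λ a b c → *-distribˡ-+ (distinct a b c) _ _) ⟩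
      ∑₃ (λ a b c → distinct a b c * (ne x c * LR x a b) + distinct a b c * (ne x a * LR x b c))
        ≡⟨ ∑₃-distrib-+ _ _ ⟩
      ∑₃ (λ a b c → distinct a b c * (ne x c * LR x a b)) + ∑₃ (λ a b c → distinct a b c * (ne x a * LR x b c))
        -- Renaming (a, b, c) cyclically turns the second sum into the first.
        ≡⟨ cong (∑₃ (λ a b c → distinct a b c * (ne x c * LR x a b)) +_) (trans (∑₃-rotate _)
             (∑₃-cong λ b c a → cong (_* (ne x a * LR x b c)) (distinct-rotate a b c))) ⟩
      ∑₃ (λ a b c → distinct a b c * (ne x c * LR x a b)) + ∑₃ (λ a b c → distinct a b c * (ne x c * LR x a b))
        ≤⟨ +-mono-≤ tp tp ⟩
      k * (∑ λ a → ∑ λ b → LR x a b) + k * (∑ λ a → ∑ λ b → LR x a b)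
        ≡⟨ cong (λ y → k * y + k * y) (∑-*-∑ (L x) (R x)) ⟨
      k * (∑ (L x) * ∑ (R x)) + k * (∑ (L x) * ∑ (R x))
        ≡⟨ cong (k * (∑ (L x) * ∑ (R x)) +_) (+-identityʳ _) ⟨
      2 * (k * (∑ (L x) * ∑ (R x))) ∎
      where tp = third-point refl x (LR x) (product-0ˡ x) (product-0ʳ x)

    total : m * ((2 + k) * ((1 + k) * σ)) ≤ ∑ λ x → 2 * (k * (∑ (L x) * ∑ (R x)))
    total = begin
      m * ((2 + k) * ((1 + k) * σ))                           ≡⟨ count-triples refl σ ⟨
      ∑₃ (λ a b c → distinct a b c * σ)                     ≤⟨ ∑₃-mono-≤ pointwise ⟩
      ∑₃ (λ a b c → ∑ λ x → distinct a b c * g a b c x)   ≡⟨ ∑₃-∑-comm (λ a b c x → distinct a b c * g a b c x) ⟩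
      ∑ (λ x → ∑₃ λ a b c → distinct a b c * g a b c x)   ≤⟨ ∑-mono-≤ at-x ⟩
      ∑ (λ x → 2 * (k * (∑ (L x) * ∑ (R x))))           ∎
      where
      pointwise : ∀ a b c → distinct a b c * σ ≤ ∑ λ x → distinct a b c * g a b c x
      pointwise a b c with a ≟ b | a ≟ c | b ≟ c
      ... | yes _ | _ | _ = z≤n
      ... | no _ | yes _ | _ = z≤n
      ... | no _ | no _ | yes _ = z≤n
      ... | no a≢b | no a≢c | no b≢c =
        subst₂ _≤_ (sym (+-identityʳ σ)) (∑-cong λ x → sym (+-identityʳ (g a b c x))) (σ≤ a b c a≢b a≢c b≢c)

    eq₁ : ∀ k → suc (k * (2 + k)) ≡ (1 + k) * (1 + k)
    eq₁ = solve-∀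
    eq₂ : ∀ m k σ → m * ((2 + k) * (2 * (2 * σ * (1 + k)))) ≡ 4 * (m * ((2 + k) * ((1 + k) * σ)))
    eq₂ = solve-∀
    eq₃ : ∀ k y → 4 * (2 * (k * y)) ≡ 2 * (k * (4 * y))
    eq₃ = solve-∀
    eq₄ : ∀ m k → m * (2 * (k * ((2 + k) * (2 + k)))) ≡ m * ((2 + k) * (2 * (k * (2 + k))))
    eq₄ = solve-∀

    bound : 2 * σ * (1 + k) ≤ k * (2 + k)
    bound = *-cancelˡ-≤ 2 (*-cancelˡ-≤ (2 + k) (*-cancelˡ-≤ m (begin
      m * ((2 + k) * (2 * (2 * σ * (1 + k))))                  ≡⟨ eq₂ m k σ ⟩
      4 * (m * ((2 + k) * ((1 + k) * σ)))                      ≤⟨ *-monoʳ-≤ 4 total ⟩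
      4 * (∑ λ x → 2 * (k * (∑ (L x) * ∑ (R x))))        ≡⟨ *-distribˡ-∑ 4 _ ⟩
      (∑ λ x → 4 * (2 * (k * (∑ (L x) * ∑ (R x)))))      ≡⟨ ∑-cong (λ x → eq₃ k (∑ (L x) * ∑ (R x))) ⟩
      (∑ λ x → 2 * (k * (4 * (∑ (L x) * ∑ (R x)))))      ≤⟨ ∑-mono-≤ (λ x → *-monoʳ-≤ 2 (*-monoʳ-≤ k (4*bichromatic≤ refl x))) ⟩
      ∑ {m} (λ _ → 2 * (k * ((2 + k) * (2 + k))))            ≡⟨ ∑-const m _ ⟩
      m * (2 * (k * ((2 + k) * (2 + k))))                      ≡⟨ eq₄ m k ⟩
      m * ((2 + k) * (2 * (k * (2 + k))))                      ∎)))

-- Gallai colourings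

-- Double negation commutes with finitely many instances of excluded middle. This lets `filter` form
-- components whose membership is not decided.
¬¬-decidable : ∀ {n} (P : Fin n → Set) → ¬ ¬ (∀ i → Dec (P i))
¬¬-decidable P = sequence (RawMonad.rawApplicative ¬¬-Monad) λ _ → ¬¬-excluded-middle

module Gallai {n : ℕ} {C : Set} (_≟ᶜ_ : DecidableEquality C)
  (col : Fin n → Fin n → C) (col-sym : ∀ x y → col x y ≡ col y x)
  (no-rainbow : ∀ x y z → col x y ≡ col y z ⊎ col y z ≡ col x z ⊎ col x y ≡ col x z)
  where

  V = Fin n

  third-side : ∀ {d x y z} → col x y ≡ d → col y z ≢ d → col x z ≢ d → col y z ≡ col x z
  third-side {x = x} {y} {z} xy≡d yz≢d xz≢d with no-rainbow x y z
  ... | inj₁ xy≡yz = contradiction (trans (sym xy≡yz) xy≡d) yz≢d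
  ... | inj₂ (inj₁ eq) = eq
  ... | inj₂ (inj₂ xy≡xz) = contradiction (trans (sym xy≡xz) xy≡d) xz≢d

  Edge : C → List V → V → V → Set
  Edge d L x y = x ∈ L × y ∈ L × col x y ≡ d

  Path : C → List V → V → V → Set
  Path d L = Star (Edge d L)

  -- Double-negated because the existence of a path is not decided; the whole descent takes place
  -- under a double negation.
  Connected : C → List V → Set
  Connected d L = ∀ {x y} → x ∈ L → y ∈ L → ¬ ¬ Path d L x y

  Path-sym : ∀ {d L x y} → Path d L x y → Path d L y x
  Path-sym = reverse λ { (x∈ , y∈ , eq) → y∈ , x∈ , trans (col-sym _ _) eq }

  -- Consecutive vertices `y` and `w` of a path of colour `d` are not joined to `x` in colour `d`,
  -- since that would put `x` into their component; the triangle `y`, `w`, `x` then forces equal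
  -- colours.
  homogeneous : ∀ {d L x y z} → x ∈ L → ¬ Path d L y x → Path d L y z → col x y ≡ col x z
  homogeneous x∈L ¬yx ε = refl
  homogeneous {d} {L} {x} {y} x∈L ¬yx (_◅_ {j = w} e@(y∈ , w∈ , yw≡d) wz) = begin
    col x y ≡⟨ col-sym x y ⟩
    col y x ≡⟨ third-side yw≡d wx≢d yx≢d ⟨
    col w x ≡⟨ col-sym w x ⟩
    col x w ≡⟨ homogeneous x∈L (λ wx → ¬yx (e ◅ wx)) wz ⟩
    _       ∎
    where
    open ≡-Reasoning
    yx≢d : col y x ≢ d
    yx≢d eq = ¬yx ((y∈ , x∈L , eq) ◅ ε)
    wx≢d : col w x ≢ d
    wx≢d eq = ¬yx (e ◅ (w∈ , x∈L , eq) ◅ ε)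

  ∈-tail : ∀ {v y : V} {L} → y ∈ v ∷ L → y ≢ v → y ∈ L
  ∈-tail (here y≡v) y≢v = contradiction y≡v y≢v
  ∈-tail (there y∈) _   = y∈

  Path-end : ∀ {d L x y} → x ∈ L → Path d L x y → y ∈ L
  Path-end x∈ ε = x∈
  Path-end _ ((_ , y∈ , _) ◅ p) = Path-end y∈ p

  neighbour : ∀ {d L x y} → Path d L x y → x ≢ y → ∃[ z ] z ∈ L × z ≢ x × col x z ≡ d
  neighbour ε x≢y = contradiction refl x≢y
  neighbour {x = x} (_◅_ {j = w} (_ , w∈ , eq) p) x≢y with w ≟ x
  -- `col` has values on the diagonal too, so a path may start with loops at `x`; they are skipped.
  ... | yes refl = neighbour p x≢y
  ... | no w≢x   = w , w∈ , w≢x , eq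

  -- The path is cut at its first arrival in `v`, so the part that is kept avoids `v` and stays in
  -- `L`.
  last-before : ∀ {d L v p} → p ≢ v → Path d (v ∷ L) p v → ∃[ a ] Path d L p a × col v a ≡ d
  last-before p≢v ε = contradiction refl p≢v
  last-before {v = v} {p} p≢v (_◅_ {j = q} (p∈ , q∈ , eq) path) with q ≟ v
  ... | yes refl = p , ε , trans (col-sym v p) eq
  ... | no q≢v with last-before q≢v path
  ...   | a , pa , va = a , (∈-tail p∈ p≢v , ∈-tail q∈ q≢v , eq) ◅ pa , va

  module _ {d : C} {L : List V} {v : V} (v∉L : v ∉ L) (connected : Connected d (v ∷ L)) where

    private
      component-neighbour : ∀ {p} → p ∈ L → ¬ ¬ (∃[ a ] a ∈ L × Path d L p a × col v a ≡ d)
      component-neighbour p∈L k = connected (there p∈L) (here refl) λ path →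
        let a , pa , va = last-before (λ { refl → v∉L p∈L }) path in k (a , Path-end p∈L pa , pa , va)

      -- A `d`-neighbour `a` of `v` in the component of `y` has the same colour to `z` as `y` has,
      -- and the triangle `v`, `a`, `z` makes that colour `f`.
      across : ∀ {y z f} → y ∈ L → z ∈ L → col v z ≡ f → f ≢ d → ¬ Path d L y z → ¬ ¬ (col z y ≡ f)
      across y∈ z∈ refl f≢d ¬yz k = component-neighbour y∈ λ (a , a∈ , ya , va) → k (begin
        _ ≡⟨ homogeneous z∈ ¬yz ya ⟩
        _ ≡⟨ col-sym _ a ⟩
        _ ≡⟨ third-side va (λ az → ¬yz (ya ◅◅ (a∈ , z∈ , az) ◅ ε)) f≢d ⟩
        _ ∎)
        where open ≡-Reasoning

      -- A `d`-neighbour `a` of `v` in the component of `w` sees `y` and `z` in one colour, as they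
      -- share another component; the triangles with `v` identify this colour with both `e` and `f`.
      within : ∀ {y z w e f} → y ∈ L → z ∈ L → w ∈ L → col v y ≡ e → col v z ≡ f → e ≢ d → f ≢ d →
               Path d L y z → ¬ Path d L y w → ¬ ¬ (e ≡ f)
      within {y} {z} y∈ z∈ w∈ refl refl e≢d f≢d yz ¬yw k = component-neighbour w∈ λ (a , a∈ , wa , va) →
        let ¬ya : ¬ Path d L y a
            ¬ya ya = ¬yw (ya ◅◅ Path-sym wa)
        in k (begin
        col v y ≡⟨ third-side va (λ ay → ¬ya (Path-sym ((a∈ , y∈ , ay) ◅ ε))) e≢d ⟨
        col a y ≡⟨ homogeneous a∈ ¬ya yz ⟩
        col a z ≡⟨ third-side va (λ az → ¬ya (yz ◅◅ Path-sym ((a∈ , z∈ , az) ◅ ε))) f≢d ⟩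
        col v z ∎)
        where open ≡-Reasoning

    -- Suppose no path joins `p` and `q` after the deletion. If `y` and `z` lie in different
    -- components, `across` used both ways gives their edge the colours `e` and `f` at once.
    -- Otherwise their component misses `p` or `q`, and `within` gives `e ≡ f`.
    delete-connected : ∀ {y z e f} → y ∈ L → z ∈ L → col v y ≡ e → col v z ≡ f →
                       e ≢ d → f ≢ d → e ≢ f → Connected d L
    delete-connected {y} {z} y∈ z∈ vy vz e≢d f≢d e≢f {p} {q} p∈ q∈ ¬pq =
      ¬¬-excluded-middle {A = Path d L y z} λ where
        (no ¬yz) → across y∈ z∈ vz f≢d ¬yz λ zy≡f →
                   across z∈ y∈ vy e≢d (¬yz ∘ Path-sym) λ yz≡e →
                   e≢f (trans (sym yz≡e) (trans (col-sym y z) zy≡f))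
        (yes yz) → ¬¬-excluded-middle {A = Path d L y p} λ where
          (no ¬yp) → within y∈ z∈ p∈ vy vz e≢d f≢d yz ¬yp e≢f
          (yes yp) → within y∈ z∈ q∈ vy vz e≢d f≢d yz (λ yq → ¬pq (Path-sym yp ◅◅ yq)) e≢f

  Connected-resp : ∀ {d L L′} → (∀ {x} → x ∈ L → x ∈ L′) → (∀ {x} → x ∈ L′ → x ∈ L) →
                   Connected d L → Connected d L′
  Connected-resp to from connected x∈ y∈ k =
    connected (from x∈) (from y∈) (k ∘ map λ (x∈ , y∈ , eq) → to x∈ , to y∈ , eq)

  -- Gyárfás–Simonyi.  A vertex v with neighbours in all three colours can be
  -- deleted without disconnecting any of them.
  not-three-connected : ∀ L {u w} → u ∈ L → w ∈ L → u ≢ w → ∀ {d e f} → d ≢ e → d ≢ f → e ≢ f →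
                        Connected d L → Connected e L → ¬ Connected f L
  not-three-connected (v ∷ L) {u} {w} u∈ w∈ u≢w d≢e d≢f e≢f D E F with _∈?_ _≟_ v L
  ... | yes v∈L = not-three-connected L (from u∈) (from w∈) u≢w d≢e d≢f e≢f (shorten D) (shorten E) (shorten F)
    where
    from : ∀ {x} → x ∈ v ∷ L → x ∈ L
    from (here refl) = v∈L
    from (there x∈)  = x∈
    shorten : ∀ {c} → Connected c (v ∷ L) → Connected c L
    shorten = Connected-resp from there
  ... | no v∉L =
    -- Different colours at `v` make `y` and `z` distinct, so the tail keeps two vertices for the
    -- induction. Each colour stays connected because of the neighbours of `v` in the other two.
    star D λ (y , y∈ , vy) → star E λ (z , z∈ , vz) → star F λ (t , t∈ , vt) →
    not-three-connected L y∈ z∈ (λ { refl → d≢e (trans (sym vy) vz) }) d≢e d≢f e≢f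
      (delete-connected v∉L D z∈ t∈ vz vt (≢-sym d≢e) (≢-sym d≢f) e≢f)
      (delete-connected v∉L E y∈ t∈ vy vt d≢e (≢-sym e≢f) d≢f)
      (delete-connected v∉L F y∈ z∈ vy vz d≢f e≢f d≢e)
    where
    other : ∃[ t ] t ∈ v ∷ L × v ≢ t
    other with v ≟ u
    ... | yes refl = w , w∈ , u≢w
    ... | no v≢u   = u , u∈ , v≢u
    star : ∀ {c} → Connected c (v ∷ L) → ¬ ¬ (∃[ y ] y ∈ L × col v y ≡ c)
    star connected k with other
    ... | t , t∈ , v≢t = connected (here refl) t∈ λ path →
      let y , y∈ , y≢v , vy = neighbour path v≢t in k (y , ∈-tail y∈ y≢v , vy)

  -- A homogeneous set as in modular decomposition: every outside vertex sees all of `L` in one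
  -- colour. `u` and `w` witness that it has two elements.
  record Module (L : List V) : Set where
    field
      unique : Unique L
      {u w}  : V
      u∈L    : u ∈ L
      w∈L    : w ∈ L
      u≢w    : u ≢ w
      twins  : ∀ {x y z} → x ∉ L → y ∈ L → z ∈ L → col x y ≡ col x z

  TwoColoured : List V → Set
  TwoColoured L = ∃[ c₁ ] ∃[ c₂ ] ∀ {x y} → x ∈ L → y ∈ L → x ≢ y → col x y ≡ c₁ ⊎ col x y ≡ c₂

  private
    module _ (none : ¬ (∃[ L ] Module L × TwoColoured L)) where

      -- Descent on the length. If a colour occurring in `L` is disconnected, one of its components
      -- is a shorter module: vertices outside `L` see it uniformly by `twins`, those inside by
      -- `homogeneous`. So all occurring colours are connected, `not-three-connected` leaves at most
      -- two, and `none` is contradicted.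
      shrink : ∀ L → Acc _<_ (length L) → ¬ Module L
      shrink L (acc rec) M = no-third-colour
        where
        open Module M

        connected : ∀ {x y} → x ∈ L → y ∈ L → x ≢ y → Connected (col x y) L
        connected {x} {y} x∈ y∈ x≢y {p} {q} p∈ q∈ ¬pq = ¬¬-decidable (Path (col x y) L x) λ path? →
          shrink (filter path? L) (rec (filter-notAll path? L (unreached path?))) record
            { unique = Unique.filter⁺ path? unique
            ; u∈L    = ∈-filter⁺ path? x∈ ε
            ; w∈L    = ∈-filter⁺ path? y∈ ((x∈ , y∈ , refl) ◅ ε)
            ; u≢w    = x≢y
            ; twins  = λ t∉ y∈ z∈ → twins′ path? t∉ (∈-filter⁻ path? y∈) (∈-filter⁻ path? z∈)
            }
          where
          -- `p` and `q` cannot both be reached, so the component is strictly shorter than `L`.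
          unreached : (∀ z → Dec (Path (col x y) L x z)) → Any.Any (λ z → ¬ Path (col x y) L x z) L
          unreached path? with path? p
          ... | no ¬xp = Any.map (λ { refl → ¬xp }) p∈
          ... | yes xp = Any.map (λ { refl xq → ¬pq (Path-sym xp ◅◅ xq) }) q∈

          twins′ : (path? : ∀ z → Dec (Path (col x y) L x z)) → ∀ {t a b} → t ∉ filter path? L →
                   a ∈ L × Path (col x y) L x a → b ∈ L × Path (col x y) L x b → col t a ≡ col t b
          twins′ path? {t} t∉ (a∈ , xa) (b∈ , xb) with _∈?_ _≟_ t L
          ... | no t∉L = twins t∉L a∈ b∈
          ... | yes t∈L = homogeneous t∈L (λ at → t∉ (∈-filter⁺ path? t∈L (xa ◅◅ at))) (Path-sym xa ◅◅ xb)

        second-colour : ∀ {x y} → x ∈ L → y ∈ L → x ≢ y → ¬ (col x y ≢ col u w)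
        second-colour {x} {y} x∈ y∈ x≢y xy≢uw = none (L , M , col u w , col x y , third-colour)
          where
          third-colour : ∀ {s t} → s ∈ L → t ∈ L → s ≢ t → col s t ≡ col u w ⊎ col s t ≡ col x y
          third-colour {s} {t} s∈ t∈ s≢t with col s t ≟ᶜ col u w | col s t ≟ᶜ col x y
          ... | yes eq | _ = inj₁ eq
          ... | no _ | yes eq = inj₂ eq
          ... | no st≢uw | no st≢xy = ⊥-elim
            (not-three-connected L u∈L w∈L u≢w (≢-sym xy≢uw) (≢-sym st≢uw) (≢-sym st≢xy)
              (connected u∈L w∈L u≢w) (connected x∈ y∈ x≢y) (connected s∈ t∈ s≢t))

        no-third-colour : ⊥
        -- Without a second colour the module is monochromatic, the case of `TwoColoured` with equal
        -- colours.
        no-third-colour = none (L , M , col u w , col u w , λ x∈ y∈ x≢y →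
          inj₁ (decidable-stable (_ ≟ᶜ _) (second-colour x∈ y∈ x≢y)))

  -- The descent starts at the set of all vertices, a module because nothing lies outside it.
  two-coloured-module : {u w : V} → u ≢ w → ¬ ¬ (∃[ L ] Module L × TwoColoured L)
  two-coloured-module {u} {w} u≢w none = shrink none (List.allFin n) (<-wellFounded _) record
    { unique = Unique.allFin⁺ n
    ; u∈L    = ∈-allFin u
    ; w∈L    = ∈-allFin w
    ; u≢w    = u≢w
    ; twins  = λ {x} x∉ → contradiction (∈-allFin x) x∉
    }

-- Counting inside decidable sets.

ind-× : ∀ {p q} {P : Set p} {Q : Set q} (d : Dec P) (e : Dec Q) → ind (d ×-dec e) ≡ ind d * ind e
ind-× (yes _) (yes _) = refl
ind-× (yes _) (no _)  = refl
ind-× (no _)  _       = refl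

ind-cover : ∀ {p q r} {P : Set p} {Q : Set q} {R : Set r} (d : Dec P) (e : Dec Q) (f : Dec R) →
            (P → Q ⊎ R) → ind d ≤ ind e + ind f
ind-cover (no _)  _       _       _ = z≤n
ind-cover (yes _) (yes _) _       _ = s≤s z≤n
ind-cover (yes _) (no _)  (yes _) _ = s≤s z≤n
ind-cover (yes p) (no ¬q) (no ¬r) P⇒Q⊎R with P⇒Q⊎R p
... | inj₁ q = contradiction q ¬q
... | inj₂ r = contradiction r ¬r

ind-split : ∀ {p q} {P : Set p} {Q : Set q} (d : Dec P) (e : Dec Q) →
            ind (d ×-dec e) + ind (d ×-dec ¬? e) ≡ ind d
ind-split (yes _) (yes _) = refl
ind-split (yes _) (no _)  = refl
ind-split (no _)  _       = refl

module _ {n p q} {P : Pred (Fin n) p} {Q : Pred (Fin n) q} (P? : Decidable P) (Q? : Decidable Q) where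

  #-split : # (λ x → P? x ×-dec Q? x) + # (λ x → P? x ×-dec ¬? (Q? x)) ≡ # P?
  #-split = trans (sym (∑-distrib-+ _ _)) (∑-cong λ x → ind-split (P? x) (Q? x))

  #-complement-≤ : ∀ {t s} → # P? ≡ t + s → # (λ x → P? x ×-dec ¬? (Q? x)) ≤ s →
                   t ≤ # (λ x → P? x ×-dec Q? x)
  #-complement-≤ {t} {s} #P≡ few = +-cancelʳ-≤ s t _
    (≤-trans (≤-reflexive (trans (sym #P≡) (sym #-split))) (+-monoʳ-≤ (# λ x → P? x ×-dec Q? x) few))

-- Choosing preimages under `f` is injective. This moves a count of vertices to positions in the
-- list of a module.
#-transfer : ∀ {m n p q} {P : Pred (Fin n) p} {Q : Pred (Fin m) q} (P? : Decidable P) (Q? : Decidable Q)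
             (f : Fin m → Fin n) → (∀ {x} → P x → ∃[ i ] f i ≡ x) → (∀ {i} → P (f i) → Q i) →
             # P? ≤ # Q?
#-transfer {P = P} P? Q? f onto P⇒Q with ≤#⇒injection P? ≤-refl
... | g , g-inj , Pg = injection⇒≤# Q?
  {g = λ j → proj₁ (onto (Pg j))}
  (λ {i} {j} eq → g-inj (trans (sym (proj₂ (onto (Pg i)))) (trans (cong f eq) (proj₂ (onto (Pg j))))))
  (λ j → P⇒Q (subst P (sym (proj₂ (onto (Pg j)))) (Pg j)))

module _ {n : ℕ} where

  Off₂ : (a b x : Fin n) → Set
  Off₂ a b x = a ≢ x × b ≢ x

  off₂? : ∀ a b → Decidable (Off₂ a b)
  off₂? a b x = ¬? (a ≟ x) ×-dec ¬? (b ≟ x)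

  #off₂ : ∀ {a b} → a ≢ b → # (off₂? a b) + 2 ≡ n
  #off₂ {a} {b} a≢b = trans (cong (_+ 2) (∑-cong λ x → ind-× (¬? (a ≟ x)) (¬? (b ≟ x)))) (∑-ne-ne a≢b)

  Off₃ : (a b c x : Fin n) → Set
  Off₃ a b c x = Off₂ a b x × c ≢ x

  off₃? : ∀ a b c → Decidable (Off₃ a b c)
  off₃? a b c x = off₂? a b x ×-dec ¬? (c ≟ x)

  #off₃ : ∀ {a b c} → a ≢ b → a ≢ c → b ≢ c → # (off₃? a b c) + 3 ≡ n
  #off₃ {a} {b} {c} a≢b a≢c b≢c = trans
    (cong (_+ 3) (∑-cong λ x → trans (ind-× (off₂? a b x) (¬? (c ≟ x))) (cong (_* ne c x) (ind-× (¬? (a ≟ x)) (¬? (b ≟ x))))))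
    (∑-ne-ne-ne a≢b a≢c b≢c)

-- Rich pairs and triples inside a two-coloured module.

module Rich {n : ℕ} {C : Set} (_≟ᶜ_ : DecidableEquality C) (col : Fin n → Fin n → C) where

  -- The vertices that can be attached to a and b (to a, b and c) when the
  -- latter are ordered as written and a gets colour α (and b colour β).
  Fit₂ : (α : C) (a b x : Fin n) → Set
  Fit₂ α a b x = col a x ≡ col b x ⊎ col a x ≡ α

  fit₂? : ∀ α a b → Decidable (Fit₂ α a b)
  fit₂? α a b x = (col a x ≟ᶜ col b x) ⊎-dec (col a x ≟ᶜ α)

  Fit₃ : (α β : C) (a b c x : Fin n) → Set
  Fit₃ α β a b c x = Fit₂ α a b x × col b x ≡ col c x ⊎ col a x ≡ α × col b x ≡ β

  fit₃? : ∀ α β a b c → Decidable (Fit₃ α β a b c)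
  fit₃? α β a b c x = (fit₂? α a b x ×-dec (col b x ≟ᶜ col c x)) ⊎-dec ((col a x ≟ᶜ α) ×-dec (col b x ≟ᶜ β))

  -- Finite data describing an orderable `K_{2,t}`; for finitely many colours its existence is
  -- decidable, which later removes the double negation.
  RichPair : ℕ → Set
  RichPair t = ∃[ a ] ∃[ b ] a ≢ b × ∃[ α ] t ≤ # (λ x → off₂? a b x ×-dec fit₂? α a b x)

  RichTriple : ℕ → Set
  RichTriple t = ∃[ a ] ∃[ b ] ∃[ c ] (a ≢ b × a ≢ c × b ≢ c) × ∃[ α ] ∃[ β ]
                 t ≤ # (λ x → off₃? a b c x ×-dec fit₃? α β a b c x)

  module _ (col-sym : ∀ x y → col x y ≡ col y x)
    (no-rainbow : ∀ x y z → col x y ≡ col y z ⊎ col y z ≡ col x z ⊎ col x y ≡ col x z) where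

    open Gallai _≟ᶜ_ col col-sym no-rainbow

    module _ {L : List V} (M : Module L) (two : TwoColoured L) where

      open Module M
      private
        c₁ = proj₁ two
        m = length L
        ℓ = List.lookup L

        ℓ-inj : ∀ {i j} → ℓ i ≡ ℓ j → i ≡ j
        ℓ-inj = lookup-injective unique

        m≤n : m ≤ n
        m≤n = injective⇒≤ ℓ-inj

        ℓ∈ : ∀ i → ℓ i ∈ L
        ℓ∈ = ∈-lookup

        -- `blue` is every colour but `c₁`, which inside the module means the second colour. The
        -- arguments of `col` are swapped to match `col a x` in `Fit₂`.
        red blue : Fin m → Fin m → Set
        red  x y = x ≢ y × col (ℓ y) (ℓ x) ≡ c₁
        blue x y = x ≢ y × col (ℓ y) (ℓ x) ≢ c₁

        red? : ∀ x y → Dec (red x y)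
        red? x y = ¬? (x ≟ y) ×-dec (col (ℓ y) (ℓ x) ≟ᶜ c₁)

        blue? : ∀ x y → Dec (blue x y)
        blue? x y = ¬? (x ≟ y) ×-dec ¬? (col (ℓ y) (ℓ x) ≟ᶜ c₁)

        red+blue : ∀ x y → ind (red? x y) + ind (blue? x y) ≡ ne x y
        red+blue x y = ind-split (¬? (x ≟ y)) (col (ℓ y) (ℓ x) ≟ᶜ c₁)

        position : ∀ {x} → x ∈ L → ∃[ i ] ℓ i ≡ x
        position x∈ = index x∈ , sym (lookup-index x∈)

        not-c₁-agree : ∀ {i j x} → ℓ i ≢ ℓ x → ℓ j ≢ ℓ x →
                       col (ℓ i) (ℓ x) ≢ c₁ → col (ℓ j) (ℓ x) ≢ c₁ → col (ℓ i) (ℓ x) ≡ col (ℓ j) (ℓ x)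
        not-c₁-agree {i} {j} {x} i≢x j≢x i≢c₁ j≢c₁
          with proj₂ (proj₂ two) (ℓ∈ i) (ℓ∈ x) i≢x | proj₂ (proj₂ two) (ℓ∈ j) (ℓ∈ x) j≢x
        ... | inj₁ eq | _ = contradiction eq i≢c₁
        ... | inj₂ _ | inj₁ eq = contradiction eq j≢c₁
        ... | inj₂ eq | inj₂ eq′ = trans eq (sym eq′)

        2≤m : 2 ≤ m
        2≤m = two-elements u∈L w∈L
          where
          two-elements : ∀ {L} → u ∈ L → w ∈ L → 2 ≤ length L
          two-elements (here u≡x) (here w≡x) = contradiction (trans u≡x (sym w≡x)) u≢w
          two-elements {_ ∷ _ ∷ _} (here _) (there _) = s≤s (s≤s z≤n)
          two-elements {_ ∷ _ ∷ _} (there _) _ = s≤s (s≤s z≤n)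

        outside : ∀ {x i j} → x ∉ L → col (ℓ i) x ≡ col (ℓ j) x
        outside x∉ = trans (col-sym _ _) (trans (twins x∉ (ℓ∈ _) (ℓ∈ _)) (col-sym _ _))

      -- Pairs of the module are tried with `α = c₁`. Outside vertices fit, and a misfit inside is
      -- blue to the first vertex and red to the second. Without a rich pair, each pair has at least
      -- s + 1 misfits among the 4s other vertices, and averaging gives 4(s + 1) ≤ m - 1 ≤ 4s + 1.
      rich-pair-in-module : ∀ {s} → n ≡ 2 + 4 * s → ¬ ¬ RichPair (3 * s)
      rich-pair-in-module {s} n≡ none =
        1+n≰n (≤-trans (≤-trans (m≤m+n (2 + 4 * s) 2) (≤-reflexive (shift s))) (≤-trans average (s≤s k≤4s)))
        where
        misfit-bound : ∀ i j → # (λ x → off₂? (ℓ i) (ℓ j) x ×-dec ¬? (fit₂? c₁ (ℓ i) (ℓ j) x)) ≤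
                       ∑ λ x → ind (blue? x i) * ind (red? x j)
        misfit-bound i j = ≤-trans
          (#-transfer (λ x → off₂? (ℓ i) (ℓ j) x ×-dec ¬? (fit₂? c₁ (ℓ i) (ℓ j) x)) (λ x → blue? x i ×-dec red? x j) ℓ onto inside)
          (≤-reflexive (∑-cong λ x → ind-× (blue? x i) (red? x j)))
          where
          onto : ∀ {x} → Off₂ (ℓ i) (ℓ j) x × ¬ Fit₂ c₁ (ℓ i) (ℓ j) x → ∃[ y ] ℓ y ≡ x
          onto {x} (_ , ¬fit) with _∈?_ _≟_ x L
          ... | yes x∈ = position x∈
          ... | no x∉ = contradiction (inj₁ (outside x∉)) ¬fit
          inside : ∀ {x} → Off₂ (ℓ i) (ℓ j) (ℓ x) × ¬ Fit₂ c₁ (ℓ i) (ℓ j) (ℓ x) → blue x i × red x j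
          inside {x} ((i≢x , j≢x) , ¬fit) =
            ((λ { refl → i≢x refl }) , ¬fit ∘ inj₂) ,
            ((λ { refl → j≢x refl }) , decidable-stable (_ ≟ᶜ _) λ j≢c₁ →
              ¬fit (inj₁ (not-c₁-agree i≢x j≢x (¬fit ∘ inj₂) j≢c₁)))

        many-misfits : ∀ i j → i ≢ j → suc s ≤ ∑ λ x → ind (blue? x i) * ind (red? x j)
        many-misfits i j i≢j = ≰⇒> λ ∑≤s → none (ℓ i , ℓ j , i≢j ∘ ℓ-inj , c₁ ,
          #-complement-≤ (off₂? (ℓ i) (ℓ j)) (fit₂? c₁ (ℓ i) (ℓ j)) #off≡ (≤-trans (misfit-bound i j) ∑≤s))
          where
          #off≡ : # (off₂? (ℓ i) (ℓ j)) ≡ 3 * s + s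
          #off≡ = trans (+-cancelʳ-≡ 2 _ _ (trans (#off₂ (i≢j ∘ ℓ-inj)) (trans n≡ (+-comm 2 (4 * s))))) (+-comm s (3 * s))

        m≡ : m ≡ 2 + (m ∸ 2)
        m≡ = sym (m+[n∸m]≡n 2≤m)

        k≤4s : m ∸ 2 ≤ 4 * s
        k≤4s = +-cancelˡ-≤ 2 _ _ (subst₂ _≤_ m≡ n≡ m≤n)

        shift : ∀ s → 2 + 4 * s + 2 ≡ 4 * suc s
        shift = solve-∀

        average : 4 * suc s ≤ suc (m ∸ 2)
        average = pair-average (λ x y → ind (red? x y)) (λ x y → ind (blue? x y)) red+blue m≡ many-misfits

      -- Here the average over triples is void; instead each vertex fits one of
      -- the two orders (u , w , c) and (c , u , w).
      private
        rich-triple-from-twins : ∀ {s} → 1 ≤ s → n ≡ 2 + 4 * s → m ≡ 2 → ¬ ¬ RichTriple (2 * s)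
        rich-triple-from-twins {s} 1≤s n≡ m≡2 none with ≤#⇒injection (off₂? u w) {t = 1} 1≤#off₂
          where
          1≤#off₂ : 1 ≤ # (off₂? u w)
          1≤#off₂ = ≤-trans (≤-trans 1≤s (m≤m+n s _))
            (≤-reflexive (sym (+-cancelʳ-≡ 2 _ (4 * s) (trans (#off₂ u≢w) (trans n≡ (+-comm 2 (4 * s)))))))
        -- There are 4s - 1 vertices besides `u`, `w`, `c`; if neither order were rich, at most 2s -
        -- 1 would fit each, 4s - 2 in all.
        ... | g , _ , g-off = 1+n≰n (begin
            2 + (2 * s + 2 * s)                   ≡⟨ cong (2 +_) (*-distribʳ-+ s 2 2) ⟨
            2 + 4 * s                             ≡⟨ n≡ ⟨
            n                                     ≡⟨ #off₃ u≢w u≢c w≢c ⟨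
            # (off₃? u w c) + 3                   ≤⟨ +-monoˡ-≤ 3 (∑-mono-≤ covered) ⟩
            ∑ (λ x → ind (first? x) + ind (second? x)) + 3 ≡⟨ cong (_+ 3) (∑-distrib-+ _ _) ⟩
            # first? + # second? + 3              ≡⟨ shift (# first?) (# second?) ⟩
            suc (suc (# first?) + suc (# second?)) ≤⟨ s≤s (+-mono-≤
              (≰⇒> λ le → none (u , w , c , (u≢w , u≢c , w≢c) , col u c , col u c , le))
              (≰⇒> λ le → none (c , u , w , (≢-sym u≢c , ≢-sym w≢c , u≢w) , col u c , col u c , le))) ⟩
            suc (2 * s + 2 * s)                   ∎)
          where
          open ≤-Reasoning
          c = g zero
          u≢c = proj₁ (g-off zero)
          w≢c = proj₂ (g-off zero)

          first? second? : ∀ x → Dec _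
          first?  x = off₃? u w c x ×-dec fit₃? (col u c) (col u c) u w c x
          second? x = off₃? c u w x ×-dec fit₃? (col u c) (col u c) c u w x

          shift : ∀ p q → p + q + 3 ≡ suc (suc p + suc q)
          shift = solve-∀

          only-two : ∀ {L x} → length L ≡ 2 → u ∈ L → w ∈ L → x ∈ L → x ≡ u ⊎ x ≡ w
          only-two {_ ∷ _ ∷ []} _ (here refl) (here refl) _ = contradiction refl u≢w
          only-two {_ ∷ _ ∷ []} _ (there (here refl)) (there (here refl)) _ = contradiction refl u≢w
          only-two {_ ∷ _ ∷ []} _ (here u≡) (there (here w≡)) (here x≡) = inj₁ (trans x≡ (sym u≡))
          only-two {_ ∷ _ ∷ []} _ (here u≡) (there (here w≡)) (there (here x≡)) = inj₂ (trans x≡ (sym w≡))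
          only-two {_ ∷ _ ∷ []} _ (there (here u≡)) (here w≡) (here x≡) = inj₂ (trans x≡ (sym w≡))
          only-two {_ ∷ _ ∷ []} _ (there (here u≡)) (here w≡) (there (here x≡)) = inj₁ (trans x≡ (sym u≡))

          u-w-twins : ∀ {x} → Off₂ u w x → col u x ≡ col w x
          u-w-twins {x} (u≢x , w≢x) = trans (col-sym u x) (trans (twins x∉L u∈L w∈L) (col-sym x w))
            where
            x∉L : x ∉ L
            x∉L x∈ with only-two m≡2 u∈L w∈L x∈
            ... | inj₁ refl = u≢x refl
            ... | inj₂ refl = w≢x refl

          fits : ∀ {x} → Off₂ u w x → Fit₃ (col u c) (col u c) u w c x ⊎ Fit₃ (col u c) (col u c) c u w x
          -- Two sides of the triangle `x`, `u`, `c` agree, and `w` behaves like `u`. If the sides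
          -- at `u` agree, `x` goes after `u` and `w`. Otherwise `c` comes first, and `x` goes right
          -- after it if the sides at `c` agree, before all three if those at `x` do.
          fits {x} off with no-rainbow x u c
          ... | inj₁ xu≡uc = inj₁ (inj₂ (ux≡uc , trans (sym (u-w-twins off)) ux≡uc))
            where ux≡uc = trans (col-sym u x) xu≡uc
          ... | inj₂ (inj₁ uc≡xc) = inj₂ (inj₁ (inj₂ (trans (col-sym c x) (sym uc≡xc)) , u-w-twins off))
          ... | inj₂ (inj₂ xu≡xc) = inj₂ (inj₁ (inj₁ (trans (col-sym c x) (trans (sym xu≡xc) (col-sym x u))) , u-w-twins off))

          covered : ∀ x → ind (off₃? u w c x) ≤ ind (first? x) + ind (second? x)
          covered x = ind-cover (off₃? u w c x) (first? x) (second? x) λ { off₃@((u≢x , w≢x) , c≢x) →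
            Sum.map (off₃ ,_) (((c≢x , u≢x) , w≢x) ,_) (fits (u≢x , w≢x)) }

      -- The order (i, j, l) is tried with both fixed colours `c₁`. A vertex of the module fails
      -- only if blue is directly followed by red among its three colours, which `weight` counts.
      -- Without a rich triple, each triple has at least 2s misfits, and averaging gives 4s ≤ m - 3,
      -- while m ≤ 4s + 2. A module of two vertices is treated separately.
      rich-triple-in-module : ∀ {s} → 1 ≤ s → n ≡ 2 + 4 * s → ¬ ¬ RichTriple (2 * s)
      rich-triple-in-module {s} 1≤s n≡ none with m≤n⇒m<n∨m≡n 2≤m
      ... | inj₁ 3≤m = <⇒≱ (+-cancelˡ-≤ 3 _ _ (≤-trans (≤-reflexive (sym (cong suc m≡))) (s≤s m≤n′))) average
        where
        k = m ∸ 3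
        m≡ : m ≡ 3 + k
        m≡ = sym (m+[n∸m]≡n 3≤m)

        m≤n′ : m ≤ 2 + 2 * (2 * s)
        m≤n′ = subst (m ≤_) (trans n≡ (cong (2 +_) (*-assoc 2 2 s))) m≤n

        weight : ∀ i j l → Fin m → ℕ
        weight i j l x = ne x l * (ind (blue? x i) * ind (red? x j)) + ne x i * (ind (blue? x j) * ind (red? x l))

        misfit? : ∀ i j l x → Dec (Off₃ (ℓ i) (ℓ j) (ℓ l) x × ¬ Fit₃ c₁ c₁ (ℓ i) (ℓ j) (ℓ l) x)
        misfit? i j l x = off₃? (ℓ i) (ℓ j) (ℓ l) x ×-dec ¬? (fit₃? c₁ c₁ (ℓ i) (ℓ j) (ℓ l) x)

        misfit-bound : ∀ i j l → # (misfit? i j l) ≤ ∑ (weight i j l)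
        misfit-bound i j l = ≤-trans
          (#-transfer (misfit? i j l) witness? ℓ onto inside)
          (∑-mono-≤ λ x → ≤-trans
            (ind-cover (witness? x) (¬? (x ≟ l) ×-dec (blue? x i ×-dec red? x j)) (¬? (x ≟ i) ×-dec (blue? x j ×-dec red? x l)) id)
            (≤-reflexive (cong₂ _+_ (product x l i j) (product x i j l))))
          where
          witness? : ∀ x → Dec (x ≢ l × blue x i × red x j ⊎ x ≢ i × blue x j × red x l)
          witness? x = (¬? (x ≟ l) ×-dec (blue? x i ×-dec red? x j)) ⊎-dec (¬? (x ≟ i) ×-dec (blue? x j ×-dec red? x l))
          product : ∀ x l i j → ind (¬? (x ≟ l) ×-dec (blue? x i ×-dec red? x j)) ≡ ne x l * (ind (blue? x i) * ind (red? x j))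
          product x l i j = trans (ind-× (¬? (x ≟ l)) (blue? x i ×-dec red? x j)) (cong (ne x l *_) (ind-× (blue? x i) (red? x j)))
          onto : ∀ {x} → Off₃ (ℓ i) (ℓ j) (ℓ l) x × ¬ Fit₃ c₁ c₁ (ℓ i) (ℓ j) (ℓ l) x → ∃[ y ] ℓ y ≡ x
          onto {x} (_ , ¬fit) with _∈?_ _≟_ x L
          ... | yes x∈ = position x∈
          ... | no x∉ = contradiction (inj₁ (inj₁ (outside x∉) , outside x∉)) ¬fit
          inside : ∀ {x} → Off₃ (ℓ i) (ℓ j) (ℓ l) (ℓ x) × ¬ Fit₃ c₁ c₁ (ℓ i) (ℓ j) (ℓ l) (ℓ x) →
                   x ≢ l × blue x i × red x j ⊎ x ≢ i × blue x j × red x l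
          inside {x} (((i≢x , j≢x) , l≢x) , ¬fit) = by-colours (_ ≟ᶜ _) (_ ≟ᶜ _) (_ ≟ᶜ _)
            where
            off : ∀ {y} → ℓ y ≢ ℓ x → x ≢ y
            off y≢x refl = y≢x refl
            by-colours : Dec (col (ℓ i) (ℓ x) ≡ c₁) → Dec (col (ℓ j) (ℓ x) ≡ c₁) → Dec (col (ℓ l) (ℓ x) ≡ c₁) →
                         x ≢ l × blue x i × red x j ⊎ x ≢ i × blue x j × red x l
            by-colours (yes i≡) (yes j≡) _ = contradiction (inj₂ (i≡ , j≡)) ¬fit
            by-colours (no i≢) (yes j≡) _ = inj₁ (off l≢x , (off i≢x , i≢) , (off j≢x , j≡))
            by-colours _ (no j≢) (yes l≡) = inj₂ (off i≢x , (off j≢x , j≢) , (off l≢x , l≡))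
            by-colours (yes i≡) (no j≢) (no l≢) = contradiction (inj₁ (inj₂ i≡ , not-c₁-agree j≢x l≢x j≢ l≢)) ¬fit
            by-colours (no i≢) (no j≢) (no l≢) =
              contradiction (inj₁ (inj₁ (not-c₁-agree i≢x j≢x i≢ j≢) , not-c₁-agree j≢x l≢x j≢ l≢)) ¬fit

        many-misfits : ∀ i j l → i ≢ j → i ≢ l → j ≢ l → 2 * s ≤ ∑ (weight i j l)
        many-misfits i j l i≢j i≢l j≢l = ≮⇒≥ λ ∑<2s →
          none (ℓ i , ℓ j , ℓ l , (i≢j ∘ ℓ-inj , i≢l ∘ ℓ-inj , j≢l ∘ ℓ-inj) , c₁ , c₁ ,
            #-complement-≤ (off₃? (ℓ i) (ℓ j) (ℓ l)) (fit₃? c₁ c₁ (ℓ i) (ℓ j) (ℓ l)) #off≡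
              (≤-trans (misfit-bound i j l) (≤-pred (≤-trans ∑<2s (≤-reflexive 2s≡)))))
          where
          2s≡ : 2 * s ≡ suc (pred (2 * s))
          2s≡ = sym (suc-pred (2 * s) ⦃ >-nonZero (≤-trans 1≤s (m≤m+n s _)) ⦄)
          -- The 4s - 1 other vertices are the 2s demanded ones and 2s - 1 tolerated misfits; `pred`
          -- is exact because `s` is positive.
          #off≡ : # (off₃? (ℓ i) (ℓ j) (ℓ l)) ≡ 2 * s + pred (2 * s)
          #off≡ = +-cancelʳ-≡ 3 _ _ (trans (#off₃ (i≢j ∘ ℓ-inj) (i≢l ∘ ℓ-inj) (j≢l ∘ ℓ-inj)) (begin
            n                                 ≡⟨ n≡ ⟩
            2 + 4 * s                         ≡⟨ cong (2 +_) (*-distribʳ-+ s 2 2) ⟩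
            2 + (2 * s + 2 * s)               ≡⟨ cong (λ y → 2 + (2 * s + y)) 2s≡ ⟩
            2 + (2 * s + suc (pred (2 * s)))  ≡⟨ shift (2 * s) (pred (2 * s)) ⟩
            2 * s + pred (2 * s) + 3          ∎))
            where
            open ≡-Reasoning
            shift : ∀ p q → 2 + (p + suc q) ≡ p + q + 3
            shift = solve-∀

        average : 2 * (2 * s) ≤ k
        average = triple-average (λ x y → ind (red? x y)) (λ x y → ind (blue? x y)) red+blue m≡ many-misfits
      ... | inj₂ 2≡m = rich-triple-from-twins 1≤s n≡ (sym 2≡m) none

-- Orderable and rainbow copies

module _ {V C : Set} {G : Graph V} (χ : EdgeColouring G C) where

  colour-irrelevant : ∀ {u v} (e f : Adj G u v) → colour χ e ≡ colour χ f
  colour-irrelevant e f = trans (colour-sym χ e (adj-sym G e)) (colour-sym χ (adj-sym G e) f)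

  -- Sorting by `rank` produces the ordering. Ties may be broken either way, hence a hypothesis with
  -- `≤` instead of strict inequality.
  orderable-by-rank : (vs : List V) → Unique vs → (∀ v → v ∈ vs) →
    (rank : V → ℕ) (c : V → C) →
    (∀ {u v} → rank u ≤ rank v → (e : Adj G u v) → colour χ e ≡ c u) → Orderable χ
  orderable-by-rank vs vs-unique vs-complete rank c forward =
    length xs , order , Vec.tabulate (c ∘ List.lookup xs ∘ ι) , λ i j i<j e → trans
      (forward (lookup-mono-≤ totalOrder (sort-↗ vs) (<⇒≤ i<j)) e)
      (sym (lookup∘tabulate (c ∘ List.lookup xs ∘ ι) i))
    where
    by-rank = On.decTotalOrder ≤-decTotalOrder rank
    open DecTotalOrder by-rank using (totalOrder)
    open Sort by-rank using (sort; sort-↭; sort-↗)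
    xs = sort vs
    ι : Fin (pred (length xs)) → Fin (length xs)
    ι i = inject≤ i pred[n]≤n
    xs-unique : Unique xs
    xs-unique = Permutation.Unique-resp-↭ (setoid V) (↭⇒↭ₛ (↭-sym (sort-↭ vs))) vs-unique
    xs-complete : ∀ v → v ∈ xs
    xs-complete v = ∈-resp-↭ (↭-sym (sort-↭ vs)) (vs-complete v)
    order : Fin (length xs) ↔ V
    order = mk↔ₛ′ (List.lookup xs) (index ∘ xs-complete) (λ v → sym (lookup-index (xs-complete v)))
      (λ i → lookup-injective xs-unique (sym (lookup-index (xs-complete (List.lookup xs i)))))

  -- The list of colours is eliminated: two edges leaving `u` forwards both carry the colour stored
  -- at the position of `u`.
  Orderable⇒rank : Orderable χ → Σ[ rank ∈ (V → ℕ) ] Injective _≡_ _≡_ rank ×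
    (∀ {u v w} (e : Adj G u v) (f : Adj G u w) → rank u < rank v → rank u < rank w → colour χ e ≡ colour χ f)
  Orderable⇒rank (suc p , σ , c , law) =
      toℕ ∘ from
    , (λ {u} {v} eq → trans (sym (strictlyInverseˡ u)) (trans (cong to (toℕ-injective eq)) (strictlyInverseˡ v)))
    , λ {u} {v} {w} e f → agree (from u) (from v) (from w) (strictlyInverseˡ u) (strictlyInverseˡ v) (strictlyInverseˡ w) e f
    where
    open Inverse σ
    agree : ∀ {u v w} x y z → to x ≡ u → to y ≡ v → to z ≡ w → (e : Adj G u v) (f : Adj G u w) →
            toℕ x < toℕ y → toℕ x < toℕ z → colour χ e ≡ colour χ f
    agree x y z refl refl refl e f x<y x<z = at (fromℕ< x<p) (toℕ-injective (trans (toℕ-inject≤ _ _) (toℕ-fromℕ< x<p))) e f x<y x<z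
      where
      x<p : toℕ x < p
      x<p = <-≤-trans x<y (≤-pred (toℕ<n y))
      at : ∀ {x} i → inject≤ i pred[n]≤n ≡ x → (e : Adj G (to x) (to y)) (f : Adj G (to x) (to z)) →
           toℕ x < toℕ y → toℕ x < toℕ z → colour χ e ≡ colour χ f
      at i refl e f x<y x<z = trans (law i y x<y e) (sym (law i z x<z f))
  Orderable⇒rank (zero , σ , c , law) =
    (λ _ → 0) , (λ {u} _ → contradiction (Inverse.from σ u) λ ()) , λ {u} _ _ _ _ → contradiction (Inverse.from σ u) λ ()

module _ {n r : ℕ} (χ : EdgeColouring (complete n) (Fin r)) (c₀ : Fin r) where

  -- The junk value c₀ on the diagonal creates no rainbow triangle.
  col : Fin n → Fin n → Fin r
  col u v with u ≟ v
  ... | yes _  = c₀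
  ... | no u≢v = colour χ u≢v

  colour≡col : ∀ {u v} (e : u ≢ v) → colour χ e ≡ col u v
  colour≡col {u} {v} e with u ≟ v
  ... | yes u≡v = contradiction u≡v e
  ... | no u≢v  = colour-irrelevant χ e u≢v

  col-sym : ∀ u v → col u v ≡ col v u
  col-sym u v with u ≟ v | v ≟ u
  ... | yes _   | yes _  = refl
  ... | yes u≡v | no v≢u = contradiction (sym u≡v) v≢u
  ... | no u≢v  | yes v≡u = contradiction (sym v≡u) u≢v
  ... | no u≢v  | no v≢u = colour-sym χ u≢v v≢u

  -- x is joined to a(0), …, a(k-1) and sits between a(τ-1) and a(τ).
  Attached : ∀ {k} → (Fin k → Fin n) → (Fin k → Fin r) → Fin n → Set
  Attached a α x = ∃[ τ ] ∃[ γ ] ∀ i → (toℕ i < τ → col (a i) x ≡ α i) × (τ ≤ toℕ i → col (a i) x ≡ γ)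

  attached⇒copy : ∀ {k t} {a : Fin k → Fin n} {g : Fin t → Fin n} (α : Fin k → Fin r) →
    Injective _≡_ _≡_ a → Injective _≡_ _≡_ g → (∀ i j → a i ≢ g j) →
    (∀ j → Attached a α (g j)) → HasOrderableCopy χ (completeBipartite k t)
  attached⇒copy {k} {t} {a} {g} α a-inj g-inj a≢g attached = copy ,
    orderable-by-rank (inherited χ copy) vertices vertices-unique vertices-complete rank c forward
    where
    V = Fin k ⊎ Fin t

    f : V → Fin n
    f (inj₁ i) = a i
    f (inj₂ j) = g j

    f-inj : Injective _≡_ _≡_ f
    f-inj {inj₁ _} {inj₁ _} eq = cong inj₁ (a-inj eq)
    f-inj {inj₁ i} {inj₂ j} eq = contradiction eq (a≢g i j)
    f-inj {inj₂ j} {inj₁ i} eq = contradiction (sym eq) (a≢g i j)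
    f-inj {inj₂ _} {inj₂ _} eq = cong inj₂ (g-inj eq)

    f-adj : ∀ {u v} → BipartiteAdj u v → f u ≢ f v
    f-adj {u} {v} uv eq = bipartiteAdj-irrefl {x = u} {v} (f-inj eq) uv

    copy : Copy (completeBipartite k t) (complete n)
    copy = record { embedding = mk↣ f-inj ; adj-pres = λ {u} {v} → f-adj {u} {v} }

    vertices : List V
    vertices = List.map inj₁ (List.allFin k) ++ List.map inj₂ (List.allFin t)

    vertices-unique : Unique vertices
    vertices-unique = Unique.++⁺ (Unique.map⁺ inj₁-injective (Unique.allFin⁺ k))
      (Unique.map⁺ inj₂-injective (Unique.allFin⁺ t))
      λ (∈₁ , ∈₂) → case-map (∈-map⁻ inj₁ ∈₁) (∈-map⁻ inj₂ ∈₂)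
      where
      case-map : ∀ {v : V} → ∃[ i ] i ∈ List.allFin k × v ≡ inj₁ i → ∃[ j ] j ∈ List.allFin t × v ≡ inj₂ j → ⊥
      case-map (_ , _ , refl) (_ , _ , ())

    vertices-complete : ∀ v → v ∈ vertices
    vertices-complete (inj₁ i) = ∈-++⁺ˡ (∈-map⁺ inj₁ (∈-allFin i))
    vertices-complete (inj₂ j) = ∈-++⁺ʳ (List.map inj₁ (List.allFin k)) (∈-map⁺ inj₂ (∈-allFin j))

    -- With odd ranks for `a i` and even ones for `g j`, a vertex of threshold τ follows exactly the
    -- `a i` with i < τ. Ties occur only among the pairwise nonadjacent `g j`.
    rank : V → ℕ
    rank (inj₁ i) = suc (2 * toℕ i)
    rank (inj₂ j) = 2 * proj₁ (attached j)

    c : V → Fin r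
    c (inj₁ i) = α i
    c (inj₂ j) = proj₁ (proj₂ (attached j))

    forward : ∀ {u v} → rank u ≤ rank v → (e : BipartiteAdj u v) →
              colour χ (f-adj {u} {v} e) ≡ c u
    forward {inj₁ i} {inj₂ j} le e = trans (colour≡col (f-adj {inj₁ i} {inj₂ j} e))
      (proj₁ (proj₂ (proj₂ (attached j)) i) (*-cancelˡ-< 2 _ _ le))
    forward {inj₂ j} {inj₁ i} le e = trans (colour≡col (f-adj {inj₂ j} {inj₁ i} e)) (trans (col-sym (g j) (a i))
      (proj₂ (proj₂ (proj₂ (attached j)) i) (≮⇒≥ λ i<τ → 1+n≰n (begin
        2 + 2 * toℕ i           ≡⟨ *-suc 2 (toℕ i) ⟨
        2 * suc (toℕ i)         ≤⟨ *-monoʳ-≤ 2 i<τ ⟩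
        2 * proj₁ (attached j)  ≤⟨ le ⟩
        suc (2 * toℕ i)         ∎))))
      where open ≤-Reasoning

  open Rich _≟_ col

  -- A vertex with equal colours to `a` and `b` is placed before both, one with colour `α` to `a`
  -- between them.
  RichPair⇒copy : ∀ {t} → RichPair t → HasOrderableCopy χ (completeBipartite 2 t)
  RichPair⇒copy (a , b , a≢b , α , t≤)
    with ≤#⇒injection (λ x → off₂? a b x ×-dec fit₂? α a b x) t≤
  ... | g , g-inj , ok = attached⇒copy {a = ab} (λ _ → α) ab-inj g-inj ab≢g attached
    where
    ab : Fin 2 → Fin n
    ab 0F = a
    ab 1F = b
    ab-inj : Injective _≡_ _≡_ ab
    ab-inj {0F} {0F} _ = refl
    ab-inj {0F} {1F} eq = contradiction eq a≢b
    ab-inj {1F} {0F} eq = contradiction (sym eq) a≢b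
    ab-inj {1F} {1F} _ = refl
    ab≢g : ∀ i j → ab i ≢ g j
    ab≢g 0F j = proj₁ (proj₁ (ok j))
    ab≢g 1F j = proj₂ (proj₁ (ok j))
    attached : ∀ j → Attached ab (λ _ → α) (g j)
    attached j with proj₂ (ok j)
    ... | inj₁ same = 0 , col b (g j) , λ { 0F → (λ ()) , λ _ → same ; 1F → (λ ()) , λ _ → refl }
    ... | inj₂ a≡α = 1 , col b (g j) , λ { 0F → (λ _ → a≡α) , λ () ; 1F → (λ { (s≤s ()) }) , λ _ → refl }

  RichTriple⇒copy : ∀ {t} → RichTriple t → HasOrderableCopy χ (completeBipartite 3 t)
  RichTriple⇒copy (a , b , c , (a≢b , a≢c , b≢c) , α , β , t≤)
    with ≤#⇒injection (λ x → off₃? a b c x ×-dec fit₃? α β a b c x) t≤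
  ... | g , g-inj , ok = attached⇒copy {a = abc} αβ abc-inj g-inj abc≢g attached
    where
    abc : Fin 3 → Fin n
    abc 0F = a
    abc 1F = b
    abc 2F = c
    αβ : Fin 3 → Fin r
    αβ 0F = α
    αβ _  = β
    abc-inj : Injective _≡_ _≡_ abc
    abc-inj {0F} {0F} _ = refl
    abc-inj {0F} {1F} eq = contradiction eq a≢b
    abc-inj {0F} {2F} eq = contradiction eq a≢c
    abc-inj {1F} {0F} eq = contradiction (sym eq) a≢b
    abc-inj {1F} {1F} _ = refl
    abc-inj {1F} {2F} eq = contradiction eq b≢c
    abc-inj {2F} {0F} eq = contradiction (sym eq) a≢c
    abc-inj {2F} {1F} eq = contradiction (sym eq) b≢c
    abc-inj {2F} {2F} _ = refl
    abc≢g : ∀ i j → abc i ≢ g j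
    abc≢g 0F j = proj₁ (proj₁ (proj₁ (ok j)))
    abc≢g 1F j = proj₂ (proj₁ (proj₁ (ok j)))
    abc≢g 2F j = proj₂ (proj₁ (ok j))
    attached : ∀ j → Attached abc αβ (g j)
    -- The three ways to fit place `g j` before `a`, between `a` and `b`, and between `b` and `c`.
    attached j with proj₂ (ok j)
    ... | inj₁ (inj₁ a≡b , b≡c) = 0 , col c (g j) , λ
      { 0F → (λ ()) , λ _ → trans a≡b b≡c ; 1F → (λ ()) , λ _ → b≡c ; 2F → (λ ()) , λ _ → refl }
    ... | inj₁ (inj₂ a≡α , b≡c) = 1 , col c (g j) , λ
      { 0F → (λ _ → a≡α) , λ () ; 1F → (λ { (s≤s ()) }) , λ _ → b≡c ; 2F → (λ { (s≤s ()) }) , λ _ → refl }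
    ... | inj₂ (a≡α , b≡β) = 2 , col c (g j) , λ
      { 0F → (λ _ → a≡α) , λ () ; 1F → (λ _ → b≡β) , (λ { (s≤s ()) }) ; 2F → (λ { (s≤s (s≤s ())) }) , λ _ → refl }

  Rainbow△ : Fin n → Fin n → Fin n → Set
  Rainbow△ x y z = col x y ≢ col y z × col y z ≢ col x z × col x y ≢ col x z

  rainbow△? : ∀ x y z → Dec (Rainbow△ x y z)
  rainbow△? x y z = ¬? (col x y ≟ col y z) ×-dec ¬? (col y z ≟ col x z) ×-dec ¬? (col x y ≟ col x z)

  rainbow△⇒copy : ∀ {x y z} → Rainbow△ x y z → HasRainbowCopy χ (complete 3)
  rainbow△⇒copy {x} {y} {z} (xy≢yz , yz≢xz , xy≢xz) = copy , λ {u} {v} {s} {t} e f eq →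
    third-determines u v s t e f (κ-inj (trans (sym (colour≡κ e)) (trans eq (colour≡κ f))))
    where
    φ : Fin 3 → Fin n
    φ 0F = x
    φ 1F = y
    φ 2F = z

    -- If two vertices coincide, two of the three colours do, whatever `col` is on the diagonal.
    x≢y : x ≢ y
    x≢y refl = yz≢xz refl
    y≢z : y ≢ z
    y≢z refl = xy≢xz refl
    x≢z : x ≢ z
    x≢z refl = xy≢yz (col-sym x y)

    φ-inj : Injective _≡_ _≡_ φ
    φ-inj {0F} {0F} _ = refl
    φ-inj {0F} {1F} eq = contradiction eq x≢y
    φ-inj {0F} {2F} eq = contradiction eq x≢z
    φ-inj {1F} {0F} eq = contradiction (sym eq) x≢y
    φ-inj {1F} {1F} _ = refl
    φ-inj {1F} {2F} eq = contradiction eq y≢z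
    φ-inj {2F} {0F} eq = contradiction (sym eq) x≢z
    φ-inj {2F} {1F} eq = contradiction (sym eq) y≢z
    φ-inj {2F} {2F} _ = refl

    copy : Copy (complete 3) (complete n)
    copy = record { embedding = mk↣ φ-inj ; adj-pres = λ u≢v eq → u≢v (φ-inj eq) }

    -- An edge is named by the opposite vertex. The last clause covers the edge between `1F` and
    -- `2F` and gives a junk value on the diagonal.
    third : Fin 3 → Fin 3 → Fin 3
    third 0F 1F = 2F
    third 1F 0F = 2F
    third 0F 2F = 1F
    third 2F 0F = 1F
    third _  _  = 0F

    third-determines : ∀ u v s t → u ≢ v → s ≢ t → third u v ≡ third s t →
                          (u ≡ s × v ≡ t) ⊎ (u ≡ t × v ≡ s)
    third-determines = from-yes (all? λ u → all? λ v → all? λ s → all? λ t →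
      ¬? (u ≟ v) →-dec ¬? (s ≟ t) →-dec (third u v ≟ third s t) →-dec
      ((u ≟ s ×-dec v ≟ t) ⊎-dec (u ≟ t ×-dec v ≟ s)))

    κ : Fin 3 → Fin r
    κ 0F = col y z
    κ 1F = col x z
    κ 2F = col x y

    κ-inj : Injective _≡_ _≡_ κ
    κ-inj {0F} {0F} _ = refl
    κ-inj {0F} {1F} eq = contradiction eq yz≢xz
    κ-inj {0F} {2F} eq = contradiction (sym eq) xy≢yz
    κ-inj {1F} {0F} eq = contradiction (sym eq) yz≢xz
    κ-inj {1F} {1F} _ = refl
    κ-inj {1F} {2F} eq = contradiction (sym eq) xy≢xz
    κ-inj {2F} {0F} eq = contradiction eq xy≢yz
    κ-inj {2F} {1F} eq = contradiction eq xy≢xz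
    κ-inj {2F} {2F} _ = refl

    col≡κ : ∀ u v → u ≢ v → col (φ u) (φ v) ≡ κ (third u v)
    col≡κ 0F 0F ne = contradiction refl ne
    col≡κ 0F 1F _ = refl
    col≡κ 0F 2F _ = refl
    col≡κ 1F 0F _ = col-sym y x
    col≡κ 1F 1F ne = contradiction refl ne
    col≡κ 1F 2F _ = refl
    col≡κ 2F 0F _ = col-sym z x
    col≡κ 2F 1F _ = col-sym z y
    col≡κ 2F 2F ne = contradiction refl ne

    colour≡κ : ∀ {u v} (e : u ≢ v) → colour χ (adj-pres copy {u} {v} e) ≡ κ (third u v)
    colour≡κ {u} {v} e = trans (colour≡col (adj-pres copy {u} {v} e)) (col≡κ u v e)

  module _ {s : ℕ} (n≡ : n ≡ 2 + 4 * s) where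

    private
      NoRainbow : Set
      NoRainbow = ∀ x y z → col x y ≡ col y z ⊎ col y z ≡ col x z ⊎ col x y ≡ col x z

      rainbow-or-not : HasRainbowCopy χ (complete 3) ⊎ NoRainbow
      rainbow-or-not with any? (λ x → any? λ y → any? λ z → rainbow△? x y z)
      ... | yes (x , y , z , rainbow) = inj₁ (rainbow△⇒copy {x} {y} {z} rainbow)
      ... | no none = inj₂ λ x y z → decidable-stable
        ((_ ≟ _) ⊎-dec (_ ≟ _) ⊎-dec (_ ≟ _))
        λ ¬eq → none (x , y , z , ¬eq ∘ inj₁ , ¬eq ∘ inj₂ ∘ inj₁ , ¬eq ∘ inj₂ ∘ inj₂)

      two-vertices : ∃[ u ] ∃[ w ] _≢_ {A = Fin n} u w
      two-vertices rewrite n≡ = 0F , 1F , λ ()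

      richPair? : ∀ t → Dec (RichPair t)
      richPair? t = any? λ a → any? λ b → ¬? (a ≟ b) ×-dec any? λ α → t ≤? _

      richTriple? : ∀ t → Dec (RichTriple t)
      richTriple? t = any? λ a → any? λ b → any? λ c →
        (¬? (a ≟ b) ×-dec ¬? (a ≟ c) ×-dec ¬? (b ≟ c)) ×-dec any? λ α → any? λ β → t ≤? _

      two-coloured : (no-rainbow : NoRainbow) → let open Gallai _≟_ col col-sym no-rainbow in
                     ¬ ¬ (∃[ L ] Module L × TwoColoured L)
      two-coloured no-rainbow = let _ , _ , u≢w = two-vertices in
        Gallai.two-coloured-module _≟_ col col-sym no-rainbow u≢w

    K₂,ₜ-or-rainbow : HasOrderableCopy χ (completeBipartite 2 (3 * s)) ⊎ HasRainbowCopy χ (complete 3)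
    K₂,ₜ-or-rainbow with rainbow-or-not
    ... | inj₁ rainbow = inj₂ rainbow
    -- A rich pair can be found by finite search, so it suffices that none is impossible.
    ... | inj₂ no-rainbow = inj₁ (RichPair⇒copy (decidable-stable (richPair? (3 * s)) λ poor →
      two-coloured no-rainbow λ (_ , M , two) → rich-pair-in-module col-sym no-rainbow M two {s} n≡ poor))

    K₃,ₜ-or-rainbow : 1 ≤ s → HasOrderableCopy χ (completeBipartite 3 (2 * s)) ⊎ HasRainbowCopy χ (complete 3)
    K₃,ₜ-or-rainbow 1≤s with rainbow-or-not
    ... | inj₁ rainbow = inj₂ rainbow
    ... | inj₂ no-rainbow = inj₁ (RichTriple⇒copy (decidable-stable (richTriple? (2 * s)) λ poor →
      two-coloured no-rainbow λ (_ , M , two) → rich-triple-in-module col-sym no-rainbow M two {s} 1≤s n≡ poor))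

-- Colourings from strongly regular graphs

ind-≤ : ∀ {p} {P : Set p} (d : Dec P) {k} → (P → 1 ≤ k) → ind d ≤ k
ind-≤ (yes p) 1≤k = 1≤k p
ind-≤ (no _)  _   = z≤n

fin2 : ∀ (α κ : Fin 2) → κ ≡ α ⊎ κ ≡ opposite α
fin2 0F 0F = inj₁ refl
fin2 0F 1F = inj₂ refl
fin2 1F 0F = inj₂ refl
fin2 1F 1F = inj₁ refl

module Paint {N s : ℕ} (N≡ : N ≡ 4 * s + 1) (1≤s : 1 ≤ s)
  (G : Graph (Fin N)) (srg : IsSRG G (2 * s) (s ∸ 1) s) where

  open IsSRG srg

  paint : Fin N → Fin N → Fin 2
  paint u v = if does (adj? G u v) then 0F else 1F

  paint-sym : ∀ u v → paint u v ≡ paint v u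
  paint-sym u v with adj? G u v | adj? G v u
  ... | yes _ | yes _ = refl
  ... | yes uv | no ¬vu = contradiction (adj-sym G uv) ¬vu
  ... | no ¬uv | yes vu = contradiction (adj-sym G vu) ¬uv
  ... | no _ | no _ = refl

  -- The adjacency matrix of colour `κ`: the graph for `0F`, its complement for `1F`. The value of
  -- `paint` on the diagonal is cut off.
  P : Fin 2 → Fin N → Fin N → ℕ
  P κ u v = ind (¬? (u ≟ v) ×-dec (paint u v ≟ κ))

  P-paint : ∀ {κ u v} → u ≢ v → paint u v ≡ κ → P κ u v ≡ 1
  P-paint u≢v eq = ind-yes (¬? (_ ≟ _) ×-dec (_ ≟ _)) (u≢v , eq)

  P-split : ∀ u v → P 0F u v + P 1F u v ≡ ne u v
  P-split u v with u ≟ v | paint u v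
  ... | yes _ | _  = refl
  ... | no _  | 0F = refl
  ... | no _  | 1F = refl

  P-adj : ∀ u v → P 0F u v ≡ ind (adj? G u v)
  P-adj u v with u ≟ v | adj? G u v
  ... | yes refl | yes uu = contradiction uu (adj-irrefl G refl)
  ... | yes refl | no _   = refl
  ... | no _     | yes _  = refl
  ... | no _     | no _   = refl

  P₀-degree : ∀ u → ∑ (P 0F u) ≡ 2 * s
  P₀-degree u = trans (∑-cong (P-adj u)) (trans (sym (count-tabulate (adj? G u) id)) (regular u))

  P-degree : ∀ κ u → ∑ (P κ u) ≡ 2 * s
  P-degree 0F u = P₀-degree u
  P-degree 1F u = +-cancelˡ-≡ (2 * s) _ _ (+-cancelʳ-≡ 1 _ _ (begin
    2 * s + ∑ (P 1F u) + 1          ≡⟨ cong (λ y → y + ∑ (P 1F u) + 1) (P₀-degree u) ⟨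
    ∑ (P 0F u) + ∑ (P 1F u) + 1     ≡⟨ cong (_+ 1) (trans (sym (∑-distrib-+ (P 0F u) (P 1F u))) (∑-cong (P-split u))) ⟩
    ∑ (ne u) + 1                    ≡⟨ ∑-ne u ⟩
    N                               ≡⟨ N≡ ⟩
    4 * s + 1                       ≡⟨ cong (_+ 1) (*-distribʳ-+ s 2 2) ⟩
    2 * s + 2 * s + 1               ∎))
    where open ≡-Reasoning

  codegree : Fin 2 → Fin 2 → Fin N → Fin N → ℕ
  codegree κ κ′ u v = ∑ λ x → P κ u x * P κ′ v x

  -- The parameters `s ∸ 1` and `s` differ exactly as the adjacency entry does, so adding that entry
  -- merges the two cases. `1≤s` keeps `s ∸ 1` exact.
  P₀-codegree : ∀ {u v} → u ≢ v → codegree 0F 0F u v + P 0F u v ≡ s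
  P₀-codegree {u} {v} u≢v = trans (cong₂ _+_ common (P-adj u v)) by-adjacency
    where
    common : codegree 0F 0F u v ≡ commonNeighbours G u v
    common = trans
      (∑-cong λ x → trans (cong₂ _*_ (P-adj u x) (P-adj v x)) (sym (ind-× (adj? G u x) (adj? G v x))))
      (sym (count-tabulate (λ x → adj? G u x ×-dec adj? G v x) id))
    by-adjacency : commonNeighbours G u v + ind (adj? G u v) ≡ s
    by-adjacency with adj? G u v
    ... | yes uv = trans (cong (_+ 1) (adjacent u v uv)) (m∸n+n≡m 1≤s)
    ... | no ¬uv = trans (+-identityʳ _) (nonadjacent u v u≢v ¬uv)

  -- The `κ`-neighbours of `u` are split by their colour towards `v`; the last term accounts for `v`
  -- itself.
  codegree-split : ∀ κ {u v} → codegree κ 0F u v + codegree κ 1F u v + P κ u v ≡ 2 * s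
  codegree-split κ {u} {v} = begin
    codegree κ 0F u v + codegree κ 1F u v + P κ u v                ≡⟨ cong (_+ P κ u v) (∑-distrib-+ _ _) ⟨
    ∑ (λ x → P κ u x * P 0F v x + P κ u x * P 1F v x) + P κ u v    ≡⟨ cong (_+ P κ u v) (∑-cong λ x → trans (sym (*-distribˡ-+ (P κ u x) (P 0F v x) (P 1F v x))) (cong (P κ u x *_) (P-split v x))) ⟩
    ∑ (λ x → P κ u x * ne v x) + P κ u v                           ≡⟨ ∑-except (P κ u) v ⟩
    ∑ (P κ u)                                                      ≡⟨ P-degree κ u ⟩
    2 * s                                                          ∎
    where open ≡-Reasoning

  codegree-swap : ∀ κ κ′ u v → codegree κ κ′ u v ≡ codegree κ′ κ v u
  codegree-swap κ κ′ u v = ∑-cong λ x → *-comm (P κ u x) (P κ′ v x)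

  -- The complement has the same parameters: by `codegree-split` the mixed codegree is s, and then
  -- so is the remaining expression.
  P-codegree : ∀ κ {u v} → u ≢ v → codegree κ κ u v + P κ u v ≡ s
  P-codegree 0F = P₀-codegree
  P-codegree 1F {u} {v} u≢v = +-cancelˡ-≡ s _ _ (begin
    s + (codegree 1F 1F u v + P 1F u v)                    ≡⟨ +-assoc s _ _ ⟨
    s + codegree 1F 1F u v + P 1F u v                      ≡⟨ cong (λ y → y + codegree 1F 1F u v + P 1F u v) mixed ⟨
    codegree 1F 0F u v + codegree 1F 1F u v + P 1F u v     ≡⟨ codegree-split 1F ⟩
    2 * s                                                  ≡⟨ cong (s +_) (+-identityʳ s) ⟩
    s + s                                                  ∎)
    where
    open ≡-Reasoning
    rearrange : ∀ p q r → p + r + q ≡ p + q + r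
    rearrange = solve-∀
    mixed : codegree 1F 0F u v ≡ s
    mixed = +-cancelˡ-≡ s _ _ (begin
      s + codegree 1F 0F u v                                 ≡⟨ cong₂ _+_ (P₀-codegree (≢-sym u≢v)) (codegree-swap 0F 1F v u) ⟨
      codegree 0F 0F v u + P 0F v u + codegree 0F 1F v u     ≡⟨ rearrange (codegree 0F 0F v u) (codegree 0F 1F v u) (P 0F v u) ⟩
      codegree 0F 0F v u + codegree 0F 1F v u + P 0F v u     ≡⟨ codegree-split 0F ⟩
      2 * s                                                  ≡⟨ cong (s +_) (+-identityʳ s) ⟩
      s + s                                                  ∎)

  P-total : ∀ α {u v} → u ≢ v → P α u v + P (opposite α) u v ≡ 1
  P-total 0F {u} {v} u≢v = trans (P-split u v) (ne-≢ u≢v)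
  P-total 1F {u} {v} u≢v = trans (+-comm (P 1F u v) (P 0F u v)) (P-total 0F u≢v)

  1≤* : ∀ {p q} → p ≡ 1 → q ≡ 1 → 1 ≤ p * q
  1≤* refl refl = s≤s z≤n

  open Rich _≟_ paint

  -- Fitting vertices are the `α`-neighbours of `a` other than `b` and the common `ᾱ`-neighbours.
  -- Adding the entries for the edge `a b` in both colours, together 1, completes the count to 2s +
  -- s.
  no-rich-pair : ¬ RichPair (3 * s)
  no-rich-pair (a , b , a≢b , α , 3s≤) = 1+n≰n (begin
    suc (3 * s)                                           ≤⟨ s≤s (≤-trans 3s≤ (∑-mono-≤ λ x → ind-≤ (off₂? a b x ×-dec fit₂? α a b x) (bound x))) ⟩
    suc (∑ λ x → P α a x * ne b x + P ᾱ a x * P ᾱ b x)     ≡⟨ cong suc (∑-distrib-+ _ _) ⟩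
    suc (∑ (λ x → P α a x * ne b x) + codegree ᾱ ᾱ a b)    ≡⟨ +-comm 1 _ ⟩
    ∑ (λ x → P α a x * ne b x) + codegree ᾱ ᾱ a b + 1      ≡⟨ cong (λ y → ∑ (λ x → P α a x * ne b x) + codegree ᾱ ᾱ a b + y) (P-total α a≢b) ⟨
    ∑ (λ x → P α a x * ne b x) + codegree ᾱ ᾱ a b + (P α a b + P ᾱ a b) ≡⟨ rearrange (∑ λ x → P α a x * ne b x) (codegree ᾱ ᾱ a b) (P α a b) (P ᾱ a b) ⟩
    (∑ (λ x → P α a x * ne b x) + P α a b) + (codegree ᾱ ᾱ a b + P ᾱ a b) ≡⟨ cong₂ _+_ (trans (∑-except (P α a) b) (P-degree α a)) (P-codegree ᾱ a≢b) ⟩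
    2 * s + s                                             ≡⟨ +-comm (2 * s) s ⟩
    3 * s                                                 ∎)
    where
    open ≤-Reasoning
    ᾱ = opposite α
    rearrange : ∀ p q r t → p + q + (r + t) ≡ (p + r) + (q + t)
    rearrange = solve-∀
    bound : ∀ x → Off₂ a b x × Fit₂ α a b x → 1 ≤ P α a x * ne b x + P ᾱ a x * P ᾱ b x
    bound x ((a≢x , b≢x) , fit) with fin2 α (paint a x) | fit
    ... | inj₁ a≡α | _ = m≤n⇒m≤n+o (P ᾱ a x * P ᾱ b x) (1≤* (P-paint a≢x a≡α) (ne-≢ b≢x))
    ... | inj₂ a≡ᾱ | inj₁ a≡b = m≤n⇒m≤o+n (P α a x * ne b x) (1≤* (P-paint a≢x a≡ᾱ) (P-paint b≢x (trans (sym a≡b) a≡ᾱ)))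
    ... | inj₂ a≡ᾱ | inj₂ a≡α = m≤n⇒m≤n+o (P ᾱ a x * P ᾱ b x) (1≤* (P-paint a≢x a≡α) (ne-≢ b≢x))

  -- For both choices of β, the vertices fitting a, b, c lie in
  -- N_α(a) ∩ N_α(y) or in N_ᾱ(y) ∩ N_ᾱ(z) with {y , z} = {b , c}.
  Covered : (α : Fin 2) (a y z x : Fin N) → Set
  Covered α a y z x = paint a x ≡ α × paint y x ≡ α ⊎ paint y x ≡ opposite α × paint z x ≡ opposite α

  -- Each of the two intersections has size s up to corrections for the excluded third vertex and
  -- for the edge between its two centres. It remains to see that the corrections `e₁` to `e₄` do
  -- not all vanish.
  cover-count : ∀ α {a y z t} {Q : Fin N → Set} (Q? : ∀ x → Dec (Q x)) → a ≢ y → a ≢ z → y ≢ z →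
    (∀ {x} → Q x → (a ≢ x × y ≢ x × z ≢ x) × Covered α a y z x) → t ≤ # Q? → t < 2 * s
  cover-count α {a} {y} {z} {t} Q? a≢y a≢z y≢z covered t≤ = begin-strict
    t                             ≤⟨ t≤ ⟩
    # Q?                          ≤⟨ ∑-mono-≤ (λ x → ind-≤ (Q? x) (bound x ∘ covered)) ⟩
    ∑ (λ x → P α a x * P α y x * ne z x + P ᾱ y x * P ᾱ z x * ne a x) ≡⟨ ∑-distrib-+ _ _ ⟩
    S + T                         <⟨ m<m+n (S + T) 1≤extra ⟩
    S + T + (e₁ + e₂ + (e₃ + e₄)) ≡⟨ rearrange S T e₁ e₂ e₃ e₄ ⟩
    (S + e₁ + e₂) + (T + e₃ + e₄)
      ≡⟨ cong₂ _+_ (trans (cong (_+ e₂) (∑-except (λ x → P α a x * P α y x) z)) (P-codegree α a≢y))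
                   (trans (cong (_+ e₄) (∑-except (λ x → P ᾱ y x * P ᾱ z x) a)) (P-codegree ᾱ y≢z)) ⟩
    s + s                         ≡⟨ cong (s +_) (+-identityʳ s) ⟨
    2 * s                         ∎
    where
    open ≤-Reasoning
    ᾱ = opposite α
    S = ∑ (λ x → P α a x * P α y x * ne z x)
    T = ∑ (λ x → P ᾱ y x * P ᾱ z x * ne a x)
    rearrange : ∀ p q i j k l → p + q + (i + j + (k + l)) ≡ (p + i + j) + (q + k + l)
    rearrange = solve-∀
    bound : ∀ x → (a ≢ x × y ≢ x × z ≢ x) × Covered α a y z x →
            1 ≤ P α a x * P α y x * ne z x + P ᾱ y x * P ᾱ z x * ne a x
    bound x ((a≢x , y≢x , z≢x) , inj₁ (a≡ , y≡)) =
      m≤n⇒m≤n+o (P ᾱ y x * P ᾱ z x * ne a x) (1≤* (cong₂ _*_ (P-paint a≢x a≡) (P-paint y≢x y≡)) (ne-≢ z≢x))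
    bound x ((a≢x , y≢x , z≢x) , inj₂ (y≡ , z≡)) =
      m≤n⇒m≤o+n (P α a x * P α y x * ne z x) (1≤* (cong₂ _*_ (P-paint y≢x y≡) (P-paint z≢x z≡)) (ne-≢ a≢x))
    e₁ = P α a z * P α y z
    e₂ = P α a y
    e₃ = P ᾱ y a * P ᾱ z a
    e₄ = P ᾱ y z
    1≤extra : 1 ≤ e₁ + e₂ + (e₃ + e₄)
    -- If `a y` has colour `α`, `e₂` counts; if `y z` has colour `ᾱ`, `e₄` does. In the remaining
    -- case the colour of `a z` decides between `e₁` and `e₃`.
    1≤extra with fin2 α (paint a y) | fin2 α (paint y z) | fin2 α (paint a z)
    ... | inj₁ ay | _ | _ = m≤n⇒m≤n+o (e₃ + e₄) (m≤n⇒m≤o+n e₁ (≤-reflexive (sym (P-paint a≢y ay))))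
    ... | inj₂ _ | inj₂ yz | _ = m≤n⇒m≤o+n (e₁ + e₂) (m≤n⇒m≤o+n e₃ (≤-reflexive (sym (P-paint y≢z yz))))
    ... | inj₂ _ | inj₁ yz | inj₁ az = m≤n⇒m≤n+o (e₃ + e₄) (m≤n⇒m≤n+o e₂ (1≤* (P-paint a≢z az) (P-paint y≢z yz)))
    ... | inj₂ ay | inj₁ _ | inj₂ az = m≤n⇒m≤o+n (e₁ + e₂) (m≤n⇒m≤n+o e₄
      (1≤* (P-paint (≢-sym a≢y) (trans (paint-sym y a) ay)) (P-paint (≢-sym a≢z) (trans (paint-sym z a) az))))

  no-rich-triple : ¬ RichTriple (2 * s)
  no-rich-triple (a , b , c , (a≢b , a≢c , b≢c) , α , β , 2s≤) with fin2 α β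
  ... | inj₁ refl = <-irrefl refl (cover-count α (λ x → off₃? a b c x ×-dec fit₃? α α a b c x) a≢b a≢c b≢c
    (λ (((a≢x , b≢x) , c≢x) , fit) → (a≢x , b≢x , c≢x) , cover fit) 2s≤)
    where
    cover : ∀ {x} → Fit₃ α α a b c x → Covered α a b c x
    cover {x} (inj₂ both) = inj₁ both
    cover {x} (inj₁ (fit , b≡c)) with fin2 α (paint b x) | fit
    ... | inj₁ b≡α | inj₁ a≡b = inj₁ (trans a≡b b≡α , b≡α)
    ... | inj₁ b≡α | inj₂ a≡α = inj₁ (a≡α , b≡α)
    ... | inj₂ b≡ᾱ | _ = inj₂ (b≡ᾱ , trans (sym b≡c) b≡ᾱ)
  -- For `β = ᾱ` the vertices `b` and `c` exchange roles in the covering.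
  ... | inj₂ refl = <-irrefl refl (cover-count α (λ x → off₃? a b c x ×-dec fit₃? α (opposite α) a b c x) a≢c a≢b (≢-sym b≢c)
    (λ (((a≢x , b≢x) , c≢x) , fit) → (a≢x , c≢x , b≢x) , cover fit) 2s≤)
    where
    cover : ∀ {x} → Fit₃ α (opposite α) a b c x → Covered α a c b x
    cover {x} (inj₂ (a≡α , b≡ᾱ)) with fin2 α (paint c x)
    ... | inj₁ c≡α = inj₁ (a≡α , c≡α)
    ... | inj₂ c≡ᾱ = inj₂ (c≡ᾱ , b≡ᾱ)
    cover {x} (inj₁ (fit , b≡c)) with fin2 α (paint b x) | fit
    ... | inj₁ b≡α | inj₁ a≡b = inj₁ (trans a≡b b≡α , trans (sym b≡c) b≡α)
    ... | inj₁ b≡α | inj₂ a≡α = inj₁ (a≡α , trans (sym b≡c) b≡α)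
    ... | inj₂ b≡ᾱ | _ = inj₂ (trans (sym b≡c) b≡ᾱ , b≡ᾱ)

-- From orderable copies back to rich pairs and triples.

module _ {N r : ℕ} (col : Fin N → Fin N → Fin (suc r)) (col-sym : ∀ u v → col u v ≡ col v u)
  {k t : ℕ} (f : Fin k ⊎ Fin t → Fin N) (f-inj : Injective _≡_ _≡_ f)
  (rank : Fin k ⊎ Fin t → ℕ) (rank-inj : Injective _≡_ _≡_ rank)
  (forward : ∀ u v w → BipartiteAdj u v → BipartiteAdj u w → rank u < rank v → rank u < rank w →
             col (f u) (f v) ≡ col (f u) (f w))
  where

  open Rich _≟_ col

  private
    a : Fin k → Fin N
    a = f ∘ inj₁

    x : Fin t → Fin N
    x = f ∘ inj₂

    x-inj : Injective _≡_ _≡_ x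
    x-inj = inj₂-injective ∘ f-inj

    a≢x : ∀ i j → a i ≢ x j
    a≢x i j eq = contradiction (f-inj eq) λ ()

    infix 4 _⊏_
    _⊏_ : Fin k → Fin k → Set
    i ⊏ i′ = rank (inj₁ i) < rank (inj₁ i′)

    ⊏⇒≢ : ∀ {i i′} → i ⊏ i′ → a i ≢ a i′
    ⊏⇒≢ i⊏i′ eq = <⇒≢ i⊏i′ (cong rank (f-inj eq))

    side : ∀ j i → rank (inj₂ j) < rank (inj₁ i) ⊎ rank (inj₁ i) < rank (inj₂ j)
    side j i with <-cmp (rank (inj₂ j)) (rank (inj₁ i))
    ... | tri< lt _ _ = inj₁ lt
    ... | tri≈ _ eq _ = contradiction (rank-inj eq) λ ()
    ... | tri> _ _ gt = inj₂ gt

    before : ∀ {j i i′} → rank (inj₂ j) < rank (inj₁ i) → rank (inj₂ j) < rank (inj₁ i′) →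
             col (a i) (x j) ≡ col (a i′) (x j)
    before {j} {i} {i′} lt lt′ = trans (col-sym (a i) (x j))
      (trans (forward (inj₂ j) (inj₁ i) (inj₁ i′) _ _ lt lt′) (col-sym (x j) (a i′)))

    after : ∀ i → ∃[ α ] ∀ j → rank (inj₁ i) < rank (inj₂ j) → col (a i) (x j) ≡ α
    after i with any? (λ j → rank (inj₁ i) <? rank (inj₂ j))
    ... | yes (j₀ , lt₀) = col (a i) (x j₀) , λ j lt → forward (inj₁ i) (inj₂ j) (inj₂ j₀) _ _ lt lt₀
    -- No vertex follows `a i`, so any colour serves; the colour type `Fin (suc r)` provides one.
    ... | no none = 0F , λ j lt → contradiction (j , lt) none

  -- A vertex before `a i` sees both ends in its own forward colour; one after it gets the forward
  -- colour `α` of `a i`.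
  ordered⇒RichPair : (∃[ i ] ∃[ i′ ] i ⊏ i′) → RichPair t
  ordered⇒RichPair (i , i′ , i⊏i′) = a i , a i′ , ⊏⇒≢ i⊏i′ , α ,
    injection⇒≤# (λ x → off₂? (a i) (a i′) x ×-dec fit₂? α (a i) (a i′) x) x-inj λ j → (a≢x i j , a≢x i′ j) , fit j
    where
    α = proj₁ (after i)
    fit : ∀ j → Fit₂ α (a i) (a i′) (x j)
    fit j with side j i
    ... | inj₁ lt = inj₁ (before lt (<-trans lt i⊏i′))
    ... | inj₂ gt = inj₂ (proj₂ (after i) j gt)

  ordered⇒RichTriple : (∃[ i ] ∃[ i′ ] ∃[ i″ ] i ⊏ i′ × i′ ⊏ i″) → RichTriple t
  ordered⇒RichTriple (i , i′ , i″ , i⊏i′ , i′⊏i″) =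
    a i , a i′ , a i″ , (⊏⇒≢ i⊏i′ , ⊏⇒≢ (<-trans i⊏i′ i′⊏i″) , ⊏⇒≢ i′⊏i″) , α , β ,
    injection⇒≤# (λ x → off₃? (a i) (a i′) (a i″) x ×-dec fit₃? α β (a i) (a i′) (a i″) x) x-inj
      λ j → ((a≢x i j , a≢x i′ j) , a≢x i″ j) , fit j
    where
    α = proj₁ (after i)
    β = proj₁ (after i′)
    fit : ∀ j → Fit₃ α β (a i) (a i′) (a i″) (x j)
    fit j with side j i | side j i′
    ... | inj₁ lt | _ = inj₁ (inj₁ (before lt (<-trans lt i⊏i′)) ,
                              before (<-trans lt i⊏i′) (<-trans lt (<-trans i⊏i′ i′⊏i″)))
    ... | inj₂ gt | inj₁ lt = inj₁ (inj₂ (proj₂ (after i) j gt) , before lt (<-trans lt i′⊏i″))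
    ... | inj₂ gt | inj₂ gt′ = inj₂ (proj₂ (after i) j gt , proj₂ (after i′) j gt′)

module _ (ρ : Fin 2 → ℕ) (ρ-inj : Injective _≡_ _≡_ ρ) where

  sort₂ : ∃[ i ] ∃[ j ] ρ i < ρ j
  sort₂ with <-cmp (ρ 0F) (ρ 1F)
  ... | tri< lt _ _ = 0F , 1F , lt
  ... | tri≈ _ eq _ = contradiction (ρ-inj eq) λ ()
  ... | tri> _ _ gt = 1F , 0F , gt

module _ (ρ : Fin 3 → ℕ) (ρ-inj : Injective _≡_ _≡_ ρ) where

  sort₃ : ∃[ i ] ∃[ j ] ∃[ l ] ρ i < ρ j × ρ j < ρ l
  sort₃ with <-cmp (ρ 0F) (ρ 1F) | <-cmp (ρ 1F) (ρ 2F) | <-cmp (ρ 0F) (ρ 2F)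
  ... | tri≈ _ eq _ | _ | _ = contradiction (ρ-inj eq) λ ()
  ... | _ | tri≈ _ eq _ | _ = contradiction (ρ-inj eq) λ ()
  ... | _ | _ | tri≈ _ eq _ = contradiction (ρ-inj eq) λ ()
  ... | tri< l01 _ _ | tri< l12 _ _ | _ = 0F , 1F , 2F , l01 , l12
  ... | tri< l01 _ _ | tri> _ _ l21 | tri< l02 _ _ = 0F , 2F , 1F , l02 , l21
  ... | tri< l01 _ _ | tri> _ _ l21 | tri> _ _ l20 = 2F , 0F , 1F , l20 , l01
  ... | tri> _ _ l10 | tri< l12 _ _ | tri< l02 _ _ = 1F , 0F , 2F , l10 , l02
  ... | tri> _ _ l10 | tri< l12 _ _ | tri> _ _ l20 = 1F , 2F , 0F , l12 , l20
  ... | tri> _ _ l10 | tri> _ _ l21 | _ = 2F , 1F , 0F , l21 , l10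

-- The two Ramsey numbers.

two-colours-no-rainbow : ∀ {n} (χ : EdgeColouring (complete n) (Fin 2)) → ¬ HasRainbowCopy χ (complete 3)
two-colours-no-rainbow χ (κ , rainbow) with pigeonhole (colour ψ {0F} {1F} (λ ())) (colour ψ {1F} {2F} (λ ())) (colour ψ {0F} {2F} (λ ()))
  where
  ψ = inherited χ κ
  pigeonhole : ∀ (p q r : Fin 2) → p ≡ q ⊎ q ≡ r ⊎ p ≡ r
  pigeonhole 0F 0F _ = inj₁ refl
  pigeonhole 1F 1F _ = inj₁ refl
  pigeonhole _ 0F 0F = inj₂ (inj₁ refl)
  pigeonhole _ 1F 1F = inj₂ (inj₁ refl)
  pigeonhole 0F _ 0F = inj₂ (inj₂ refl)
  pigeonhole 1F _ 1F = inj₂ (inj₂ refl)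
... | inj₁ eq with rainbow {0F} {1F} {1F} {2F} (λ ()) (λ ()) eq
...   | inj₁ (() , _)
...   | inj₂ (() , _)
two-colours-no-rainbow χ (κ , rainbow) | inj₂ (inj₁ eq) with rainbow {1F} {2F} {0F} {2F} (λ ()) (λ ()) eq
...   | inj₁ (() , _)
...   | inj₂ (() , _)
two-colours-no-rainbow χ (κ , rainbow) | inj₂ (inj₂ eq) with rainbow {0F} {1F} {0F} {2F} (λ ()) (λ ()) eq
...   | inj₁ (_ , ())
...   | inj₂ (() , _)

-- For two colours a rainbow triangle is impossible, so the property defining `CR` implies the one
-- defining `r′₂`. One upper bound and one lower bound then settle both numbers.
minimum-both : ∀ {V} {H : Graph V} {m} →
  (∀ r (χ : EdgeColouring (complete m) (Fin r)) → HasOrderableCopy χ H ⊎ HasRainbowCopy χ (complete 3)) →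
  (∀ n → ((χ : EdgeColouring (complete n) (Fin 2)) → HasOrderableCopy χ H) → m ≤ n) →
  (r′₂ H ≔ m) × (CR[ H , complete 3 ]≔ m)
minimum-both {H = H} upper lower =
    ((λ χ → orderable χ (upper 2 χ)) , lower)
  , (upper , λ n P → lower n λ χ → orderable χ (P 2 χ))
  where
  orderable : ∀ {n} (χ : EdgeColouring (complete n) (Fin 2)) →
              HasOrderableCopy χ H ⊎ HasRainbowCopy χ (complete 3) → HasOrderableCopy χ H
  orderable χ (inj₁ copy)    = copy
  orderable χ (inj₂ rainbow) = contradiction rainbow (two-colours-no-rainbow χ)

module _ {N s : ℕ} (N≡ : N ≡ 4 * s + 1) (1≤s : 1 ≤ s) (srg : SRGExists N (2 * s) (s ∸ 1) s) where

  private
    open Paint N≡ 1≤s (proj₁ srg) (proj₂ srg)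
    open Rich _≟_ paint

    module _ {n : ℕ} (n≤N : n ≤ N) where

      -- Restricting the painting to the first `n` vertices refutes every `n ≤ N` at once.
      painted : EdgeColouring (complete n) (Fin 2)
      painted = record
        { colour     = λ {u} {v} _ → paint (inject≤ u n≤N) (inject≤ v n≤N)
        ; colour-sym = λ {u} {v} _ _ → paint-sym (inject≤ u n≤N) (inject≤ v n≤N)
        }

      module _ {k t : ℕ} (copy : Copy (completeBipartite k t) (complete n)) (ord : Orderable (inherited painted copy)) where

        f : Fin k ⊎ Fin t → Fin N
        f v = inject≤ (Injection.to (embedding copy) v) n≤N

        f-inj : Injective _≡_ _≡_ f
        f-inj = Injection.injective (embedding copy) ∘ inject≤-injective n≤N n≤N _ _

        rank = proj₁ (Orderable⇒rank (inherited painted copy) ord)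
        rank-inj = proj₁ (proj₂ (Orderable⇒rank (inherited painted copy) ord))
        forward = proj₂ (proj₂ (Orderable⇒rank (inherited painted copy) ord))

        rank₁-inj : Injective _≡_ _≡_ (rank ∘ inj₁)
        rank₁-inj = inj₁-injective ∘ rank-inj

      no-K₂,ₜ : ¬ HasOrderableCopy painted (completeBipartite 2 (3 * s))
      no-K₂,ₜ (copy , ord) = no-rich-pair (ordered⇒RichPair paint paint-sym (f copy ord) (f-inj copy ord)
        (rank copy ord) (rank-inj copy ord) (λ u v w e e′ → forward copy ord {u} {v} {w} e e′)
        (sort₂ (rank copy ord ∘ inj₁) (rank₁-inj copy ord)))

      no-K₃,ₜ : ¬ HasOrderableCopy painted (completeBipartite 3 (2 * s))
      no-K₃,ₜ (copy , ord) = no-rich-triple (ordered⇒RichTriple paint paint-sym (f copy ord) (f-inj copy ord)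
        (rank copy ord) (rank-inj copy ord) (λ u v w e e′ → forward copy ord {u} {v} {w} e e′)
        (sort₃ (rank copy ord ∘ inj₁) (rank₁-inj copy ord)))

    n≤N : ∀ {n} → n < 2 + 4 * s → n ≤ N
    n≤N (s≤s n≤) = ≤-trans n≤ (≤-reflexive (trans (+-comm 1 (4 * s)) (sym N≡)))

    -- The colour of one edge supplies the diagonal value of `col`, as `Fin r` alone need not be
    -- inhabited.
    default : ∀ {r} → EdgeColouring (complete (2 + 4 * s)) (Fin r) → Fin r
    default χ = colour χ {0F} {1F} λ ()

  K₂,ₜ-numbers : (r′₂ completeBipartite 2 (3 * s) ≔ 2 + 4 * s) ×
                 (CR[ completeBipartite 2 (3 * s) , complete 3 ]≔ 2 + 4 * s)
  K₂,ₜ-numbers = minimum-both (λ r χ → K₂,ₜ-or-rainbow χ (default χ) {s} refl)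
    λ n P → ≮⇒≥ λ n< → no-K₂,ₜ (n≤N n<) (P (painted (n≤N n<)))

  K₃,ₜ-numbers : (r′₂ completeBipartite 3 (2 * s) ≔ 2 + 4 * s) ×
                 (CR[ completeBipartite 3 (2 * s) , complete 3 ]≔ 2 + 4 * s)
  K₃,ₜ-numbers = minimum-both (λ r χ → K₃,ₜ-or-rainbow χ (default χ) {s} refl 1≤s)
    λ n P → ≮⇒≥ λ n< → no-K₃,ₜ (n≤N n<) (P (painted (n≤N n<)))

-- Matching the parameters stated in terms of `t`.

SRGExists-cong : ∀ {n k l m n′ k′ l′ m′} → n ≡ n′ → k ≡ k′ → l ≡ l′ → m ≡ m′ →
                 SRGExists n k l m → SRGExists n′ k′ l′ m′
SRGExists-cong refl refl refl refl srg = srg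

1≤factor : ∀ q d → 0 < q * d → 1 ≤ q
1≤factor (suc q) d _ = s≤s z≤n

theorem1p9 : (t : ℕ) → 0 < t →
    ( 3 ∣ t →
    let n = (4 * t) / 3 + 1 in
    SRGExists n ((n ∸ 1) / 2) ((n ∸ 5) / 4) ((n ∸ 1) / 4) →
    (r′₂ completeBipartite 2 t ≔ (4 * t) / 3 + 2) ×
    (CR[ completeBipartite 2 t , complete 3 ]≔ (4 * t) / 3 + 2) )
    ×
    ( 2 ∣ t →
    SRGExists (2 * t + 1) t (t / 2 ∸ 1) (t / 2) →
    (r′₂ completeBipartite 3 t ≔ 2 * t + 2) ×
    (CR[ completeBipartite 3 t , complete 3 ]≔ 2 * t + 2) )
theorem1p9 t 0<t = part-i , part-ii
  where
  part-i : 3 ∣ t →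
    let n = (4 * t) / 3 + 1 in
    SRGExists n ((n ∸ 1) / 2) ((n ∸ 5) / 4) ((n ∸ 1) / 4) →
    (r′₂ completeBipartite 2 t ≔ (4 * t) / 3 + 2) ×
    (CR[ completeBipartite 2 t , complete 3 ]≔ (4 * t) / 3 + 2)
  part-i (divides q refl) srg = subst₂
    (λ t m → (r′₂ completeBipartite 2 t ≔ m) × (CR[ completeBipartite 2 t , complete 3 ]≔ m))
    (*-comm 3 q) (trans (+-comm 2 (4 * q)) (cong (_+ 2) (sym 4t/3≡)))
    (K₂,ₜ-numbers refl (1≤factor q 3 0<t) (SRGExists-cong (cong (_+ 1) 4t/3≡) k≡ l≡ m≡ srg))
    where
    4t/3≡ : (4 * (q * 3)) / 3 ≡ 4 * q
    4t/3≡ = trans (/-congˡ (sym (*-assoc 4 q 3))) (m*n/n≡m (4 * q) 3)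
    n∸1≡ : (4 * (q * 3)) / 3 + 1 ∸ 1 ≡ 4 * q
    n∸1≡ = trans (m+n∸n≡m ((4 * (q * 3)) / 3) 1) 4t/3≡
    k≡ : ((4 * (q * 3)) / 3 + 1 ∸ 1) / 2 ≡ 2 * q
    k≡ = trans (/-congˡ (trans n∸1≡ (4q≡ q))) (m*n/n≡m (2 * q) 2)
      where
      4q≡ : ∀ q → 4 * q ≡ 2 * q * 2
      4q≡ = solve-∀
    m≡ : ((4 * (q * 3)) / 3 + 1 ∸ 1) / 4 ≡ q
    m≡ = trans (/-congˡ (trans n∸1≡ (*-comm 4 q))) (m*n/n≡m q 4)
    l≡ : ((4 * (q * 3)) / 3 + 1 ∸ 5) / 4 ≡ q ∸ 1
    l≡ = trans (/-congˡ (trans (cong (λ y → y + 1 ∸ 5) 4t/3≡) (4q+1∸5≡ q))) (m*n/n≡m (q ∸ 1) 4)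
      where
      4q+1∸5≡ : ∀ q → 4 * q + 1 ∸ 5 ≡ (q ∸ 1) * 4
      4q+1∸5≡ zero = refl
      4q+1∸5≡ (suc p) = trans (cong (_∸ 5) (shift p)) (m+n∸m≡n 5 (p * 4))
        where
        shift : ∀ p → 4 * suc p + 1 ≡ 5 + p * 4
        shift = solve-∀

  part-ii : 2 ∣ t →
    SRGExists (2 * t + 1) t (t / 2 ∸ 1) (t / 2) →
    (r′₂ completeBipartite 3 t ≔ 2 * t + 2) ×
    (CR[ completeBipartite 3 t , complete 3 ]≔ 2 * t + 2)
  part-ii (divides q refl) srg = subst₂
    (λ t m → (r′₂ completeBipartite 3 t ≔ m) × (CR[ completeBipartite 3 t , complete 3 ]≔ m))
    (*-comm 2 q) (trans (+-comm 2 (4 * q)) (cong (_+ 2) (sym (2t≡ q))))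
    (K₃,ₜ-numbers refl (1≤factor q 2 0<t)
      (SRGExists-cong (cong (_+ 1) (2t≡ q)) (*-comm q 2) (cong (_∸ 1) (m*n/n≡m q 2)) (m*n/n≡m q 2) srg))
    where
    2t≡ : ∀ q → 2 * (q * 2) ≡ 4 * q
    2t≡ = solve-∀
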